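{- Let $\tilde{\mathbf{x}}=(x_s)\in(\mathbb{C}^*)^L$ satisfy the K-hexahedron equations. (a) For each $i\in\mathbb{Z}$ let $\alpha_i,\beta_i,\gamma_i\in\{ -1,1\}$, and define $\tilde{\mathbf{y}}=(y_s)\in(\mathbb{C}^*)^L$ by $y_{(a,b,c)}=x_{(a,b,c)}$, $y_{(a,b+\frac12,c+\frac12)}=\beta_b\gamma_c\,x_{(a,b+\frac12,c+\frac12)}$, $y_{(a+\frac12,b,c+\frac12)}=\alpha_a\gamma_c\,x_{(a+\frac12,b,c+\frac12)}$, $y_{(a+\frac12,b+\frac12,c)}=\alpha_a\beta_b\,x_{(a+\frac12,b+\frac12,c)}$ for all $(a,b,c)\in\mathbb{Z}^3$. Then $\tilde{\mathbf{y}}$ satisfies the K-hexahedron equations. (b) Conversely, if $\tilde{\mathbf{y}}=(y_s)\in(\mathbb{C}^*)^L$ satisfies the K-hexahedron equations and $y_s=x_s$ for all $s\in\mathbb{Z}^3$, then there exist signs $\alpha_i,\beta_i,\gamma_i\in\{ -1,1\}$, $i\in\mathbb{Z}$, such that $\tilde{\mathbf{y}}$ is given by the formulas in (a) for all $(a,b,c)\in\mathbb{Z}^3$.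
   Context: $L=\{(i,j,k)\in\mathbb{R}^3: 2i,2j,2k,i+j+k\in\mathbb{Z}\}$, i.e. $\mathbb{Z}^3$ together with the centers of unit squares with vertices in $\mathbb{Z}^3$. An array $\tilde{\mathbf{x}}=(x_s)\in\mathbb{C}^L$ with $x_s\ne0$ for $s\in\mathbb{Z}^3$ satisfies the K-hexahedron equations if (i) for every $s\in L\setminus\mathbb{Z}^3$, $x_s^2=x_{v_1}x_{v_3}+x_{v_2}x_{v_4}$, where $v_1,v_2,v_3,v_4$ are the vertices in cyclic order of the unit square centered at $s$; and (ii) for every $v\in\mathbb{Z}^3$, writing $z_{ijk}=x_{v+(i,j,k)}$: $z_{1\frac12\frac12}=(z_{\frac120\frac12}z_{\frac12\frac120}+z_{0\frac12\frac12}z_{100})/z_{000}$, $z_{\frac121\frac12}=(z_{0\frac12\frac12}z_{\frac12\frac120}+z_{\frac120\frac12}z_{010})/z_{000}$, $z_{\frac12\frac121}=(z_{0\frac12\frac12}z_{\frac120\frac12}+z_{\frac12\frac120}z_{001})/z_{000}$, $z_{111}=(A+2z_{0\frac12\frac12}z_{\frac120\frac12}z_{\frac12\frac120})/z_{000}^2$ with $A=2z_{100}z_{010}z_{001}+z_{000}(z_{100}z_{011}+z_{010}z_{101}+z_{001}z_{110})$. -}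

module Defs where

open import Data.Integer.Base using (ℤ) renaming (suc to sucℤ)
open import Data.Nat.Base as ℕ using (ℕ; _⊔_)
import Data.Nat.Properties as ℕ
open import Data.Maybe using (Is-just; to-witness)
open import Data.Maybe.Relation.Unary.Any using (just)
open import Data.Product.Base using (_×_; _,_; ∃; proj₁; proj₂)
open import Data.Rational.Base as ℚ using (ℚ; 0ℚ; 1ℚ; ∣_∣)
import Data.Rational.Properties as ℚ
open import Data.Rational.Solver using (module +-*-Solver)
open import Data.Sign.Base as Sign using (Sign)
open import Data.Vec.Base as Vec using ()
open import Data.Vec.N-ary using (N-ary; Eq; curryⁿ; _$ⁿ_; curryⁿ-cong)
open import Relation.Binary.PropositionalEquality using (_≡_; refl; sym; trans; cong; cong₂; subst)
open import Relation.Nullary.Decidable using (yes; no)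
open import Relation.Nullary.Negation using (contradiction)

-- Totalised inverse: 0 ↦ 0.
inv : ℚ → ℚ
inv p with p ℚ.≟ 0ℚ
... | yes _   = 0ℚ
... | no p≢0 = ℚ.1/_ p {{ℚ.≢-nonZero p≢0}}

module RationalLemmas where

  -- Like +-*-Solver.solve, but compares normal forms as polynomials rather
  -- than through their values at variables, which unfold badly in ℚ.
  module _ where
    open +-*-Solver

    solveℚ : ∀ n (f : N-ary n (Polynomial n) (Polynomial n × Polynomial n)) →
      let e = _$ⁿ_ {n = n} f (Vec.map var (Vec.allFin n)) in
      Is-just (normalise (proj₁ e) ≟N normalise (proj₂ e)) →
      Eq n _≡_ (curryⁿ ⟦ proj₁ e ⟧) (curryⁿ ⟦ proj₂ e ⟧)
    solveℚ n f eq = curryⁿ-cong _≡_ {n = n} ⟦ proj₁ e ⟧ ⟦ proj₂ e ⟧ λ ρ →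
      trans (sym (correct (proj₁ e) ρ))
        (trans (⟦ to-witness eq ⟧N-cong ρ) (correct (proj₂ e) ρ))
      where e = _$ⁿ_ {n = n} f (Vec.map var (Vec.allFin n))

  <⇒≢0 : ∀ {p} → 0ℚ ℚ.< p → p ≡ 0ℚ → ∀ {A : Set} → A
  <⇒≢0 0<p refl = contradiction 0<p (ℚ.<-irrefl refl)

  inv-pos : ∀ {p} → 0ℚ ℚ.< p → 0ℚ ℚ.< inv p
  inv-pos {p} 0<p with p ℚ.≟ 0ℚ
  ... | yes p≡0 = <⇒≢0 0<p p≡0
  ... | no p≢0  = ℚ.positive⁻¹ _ {{ℚ.1/pos⇒pos p {{ℚ.positive 0<p}}}}

  *-inv : ∀ {p} → 0ℚ ℚ.< p → p ℚ.* inv p ≡ 1ℚ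
  *-inv {p} 0<p with p ℚ.≟ 0ℚ
  ... | yes p≡0 = <⇒≢0 0<p p≡0
  ... | no p≢0  = ℚ.*-inverseʳ p {{ℚ.≢-nonZero p≢0}}

  *-pos : ∀ {p q} → 0ℚ ℚ.< p → 0ℚ ℚ.< q → 0ℚ ℚ.< p ℚ.* q
  *-pos {p} {q} 0<p 0<q =
    ℚ.positive⁻¹ _ {{ℚ.pos*pos⇒pos p {{ℚ.positive 0<p}} q {{ℚ.positive 0<q}}}}

  +-pos : ∀ {p q} → 0ℚ ℚ.< p → 0ℚ ℚ.< q → 0ℚ ℚ.< p ℚ.+ q
  +-pos = ℚ.+-mono-<

  0<1 : 0ℚ ℚ.< 1ℚ
  0<1 = ℚ.positive⁻¹ 1ℚ

  *-mono-≤ : ∀ {p q r s} → 0ℚ ℚ.≤ p → p ℚ.≤ q → 0ℚ ℚ.≤ r → r ℚ.≤ s →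
             p ℚ.* r ℚ.≤ q ℚ.* s
  *-mono-≤ {p} {q} {r} {s} 0≤p p≤q 0≤r r≤s = ℚ.≤-trans
    (ℚ.*-monoʳ-≤-nonNeg r {{ℚ.nonNegative 0≤r}} p≤q)
    (ℚ.*-monoˡ-≤-nonNeg q {{ℚ.nonNegative (ℚ.≤-trans 0≤p p≤q)}} r≤s)

  quotient : ∀ {ε C} → 0ℚ ℚ.< ε → 0ℚ ℚ.< C → ∃ λ δ → 0ℚ ℚ.< δ × C ℚ.* δ ≡ ε
  quotient {ε} {C} 0<ε 0<C =
    inv C ℚ.* ε , *-pos (inv-pos 0<C) 0<ε ,
    trans (sym (ℚ.*-assoc C (inv C) ε))
      (trans (cong (ℚ._* ε) (*-inv 0<C)) (ℚ.*-identityˡ ε))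

  ∣*∣-≤ : ∀ p q {B} → ∣ p ∣ ℚ.≤ B → ∣ p ℚ.* q ∣ ℚ.≤ B ℚ.* ∣ q ∣
  ∣*∣-≤ p q {B} h = subst (ℚ._≤ B ℚ.* ∣ q ∣) (sym (ℚ.∣p*q∣≡∣p∣*∣q∣ p q))
    (ℚ.*-monoʳ-≤-nonNeg ∣ q ∣ {{ℚ.nonNegative (ℚ.0≤∣p∣ q)}} {∣ p ∣} {B} h)

  distance-* : ∀ a b c d {B C δ} → 0ℚ ℚ.< B → 0ℚ ℚ.< C → ∣ a ∣ ℚ.≤ B → ∣ d ∣ ℚ.≤ C →
    ∣ a ℚ.- c ∣ ℚ.< δ → ∣ b ℚ.- d ∣ ℚ.< δ → ∣ a ℚ.* b ℚ.- c ℚ.* d ∣ ℚ.< (B ℚ.+ C) ℚ.* δ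
  distance-* a b c d {B} {C} {δ} 0<B 0<C a≤B d≤C ac bd = begin-strict
    ∣ a ℚ.* b ℚ.- c ℚ.* d ∣
      ≡⟨ cong ∣_∣ (solveℚ 4 (λ a b c d → a :* b :- c :* d := a :* (b :- d) :+ d :* (a :- c)) (just _) a b c d) ⟩
    ∣ a ℚ.* (b ℚ.- d) ℚ.+ d ℚ.* (a ℚ.- c) ∣
      ≤⟨ ℚ.∣p+q∣≤∣p∣+∣q∣ (a ℚ.* (b ℚ.- d)) (d ℚ.* (a ℚ.- c)) ⟩
    ∣ a ℚ.* (b ℚ.- d) ∣ ℚ.+ ∣ d ℚ.* (a ℚ.- c) ∣
      ≤⟨ ℚ.+-mono-≤ {∣ a ℚ.* (b ℚ.- d) ∣} {B ℚ.* ∣ b ℚ.- d ∣} {∣ d ℚ.* (a ℚ.- c) ∣} {C ℚ.* ∣ a ℚ.- c ∣}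
           (∣*∣-≤ a (b ℚ.- d) a≤B) (∣*∣-≤ d (a ℚ.- c) d≤C) ⟩
    B ℚ.* ∣ b ℚ.- d ∣ ℚ.+ C ℚ.* ∣ a ℚ.- c ∣
      <⟨ ℚ.+-mono-< {B ℚ.* ∣ b ℚ.- d ∣} {B ℚ.* δ} {C ℚ.* ∣ a ℚ.- c ∣} {C ℚ.* δ}
           (ℚ.*-monoʳ-<-pos B {{ℚ.positive 0<B}} {∣ b ℚ.- d ∣} {δ} bd)
           (ℚ.*-monoʳ-<-pos C {{ℚ.positive 0<C}} {∣ a ℚ.- c ∣} {δ} ac) ⟩
    B ℚ.* δ ℚ.+ C ℚ.* δ
      ≡⟨ ℚ.*-distribʳ-+ δ B C ⟨
    (B ℚ.+ C) ℚ.* δ ∎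
    where
    open ℚ.≤-Reasoning
    open +-*-Solver

  inv-anti : ∀ {p q} → 0ℚ ℚ.< p → p ℚ.≤ q → inv q ℚ.≤ inv p
  inv-anti {p} {q} 0<p p≤q = begin
    inv q                      ≡⟨ ℚ.*-identityʳ (inv q) ⟨
    inv q ℚ.* 1ℚ               ≡⟨ cong (inv q ℚ.*_) (*-inv 0<p) ⟨
    inv q ℚ.* (p ℚ.* inv p)    ≤⟨ ℚ.*-monoˡ-≤-nonNeg (inv q) {{ℚ.nonNegative (ℚ.<⇒≤ 0<iq)}}
                                    (ℚ.*-monoʳ-≤-nonNeg (inv p) {{ℚ.nonNegative (ℚ.<⇒≤ (inv-pos 0<p))}} p≤q) ⟩
    inv q ℚ.* (q ℚ.* inv p)    ≡⟨ solveℚ 3 (λ a b c → a :* (b :* c) := (b :* a) :* c) (just _) (inv q) q (inv p) ⟩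
    (q ℚ.* inv q) ℚ.* inv p    ≡⟨ cong (ℚ._* inv p) (*-inv 0<q) ⟩
    1ℚ ℚ.* inv p               ≡⟨ ℚ.*-identityˡ (inv p) ⟩
    inv p                      ∎
    where
    open ℚ.≤-Reasoning
    open +-*-Solver
    0<q = ℚ.<-≤-trans 0<p p≤q
    0<iq = inv-pos 0<q

  distance-inv : ∀ a c {η δ} → 0ℚ ℚ.< η → η ℚ.≤ a → η ℚ.≤ c → ∣ c ℚ.- a ∣ ℚ.< δ →
    ∣ inv a ℚ.- inv c ∣ ℚ.< (inv η ℚ.* inv η) ℚ.* δ
  distance-inv a c {η} {δ} 0<η η≤a η≤c ca = begin-strict
    ∣ inv a ℚ.- inv c ∣
      ≡⟨ cong ∣_∣ (cong₂ ℚ._-_ (one (inv a) c 0<c) (one (inv c) a 0<a)) ⟩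
    ∣ inv a ℚ.* (c ℚ.* inv c) ℚ.- inv c ℚ.* (a ℚ.* inv a) ∣
      ≡⟨ cong ∣_∣ (solveℚ 4 (λ a c i j → i :* (c :* j) :- j :* (a :* i) := (i :* j) :* (c :- a)) (just _) a c (inv a) (inv c)) ⟩
    ∣ (inv a ℚ.* inv c) ℚ.* (c ℚ.- a) ∣
      ≤⟨ ∣*∣-≤ (inv a ℚ.* inv c) (c ℚ.- a) bound ⟩
    (inv η ℚ.* inv η) ℚ.* ∣ c ℚ.- a ∣
      <⟨ ℚ.*-monoʳ-<-pos (inv η ℚ.* inv η) {{ℚ.positive (*-pos (inv-pos 0<η) (inv-pos 0<η))}} {∣ c ℚ.- a ∣} {δ} ca ⟩
    (inv η ℚ.* inv η) ℚ.* δ ∎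
    where
    open ℚ.≤-Reasoning
    open +-*-Solver
    0<a = ℚ.<-≤-trans 0<η η≤a
    0<c = ℚ.<-≤-trans 0<η η≤c
    one : ∀ p q → 0ℚ ℚ.< q → p ≡ p ℚ.* (q ℚ.* inv q)
    one p q 0<q = trans (sym (ℚ.*-identityʳ p)) (cong (p ℚ.*_) (sym (*-inv 0<q)))
    bound : ∣ inv a ℚ.* inv c ∣ ℚ.≤ inv η ℚ.* inv η
    bound = subst (ℚ._≤ inv η ℚ.* inv η)
      (sym (ℚ.0≤p⇒∣p∣≡p (ℚ.<⇒≤ (*-pos (inv-pos 0<a) (inv-pos 0<c)))))
      (*-mono-≤ (ℚ.<⇒≤ (inv-pos 0<a)) (inv-anti 0<η η≤a) (ℚ.<⇒≤ (inv-pos 0<c)) (inv-anti 0<η η≤c))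

  ≤⊔ˡ : ∀ {m n k} → m ⊔ n ℕ.≤ k → m ℕ.≤ k
  ≤⊔ˡ {m} {n} = ℕ.≤-trans (ℕ.m≤m⊔n m n)

  ≤⊔ʳ : ∀ {m n k} → m ⊔ n ℕ.≤ k → n ℕ.≤ k
  ≤⊔ʳ {m} {n} = ℕ.≤-trans (ℕ.m≤n⊔m m n)

open RationalLemmas

-- Reals are Cauchy sequences of rationals, with _≈ℝ_ (not _≡_) as equality.
Cauchy : (ℕ → ℚ) → Set
Cauchy f = ∀ ε → 0ℚ ℚ.< ε →
  ∃ λ N → ∀ m n → N ℕ.≤ m → N ℕ.≤ n → ∣ f m ℚ.- f n ∣ ℚ.< ε

record ℝ : Set where
  constructor mkℝ
  field
    seq    : ℕ → ℚ
    cauchy : Cauchy seq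

open ℝ public

infix  4 _≈ℝ_
infixl 6 _+ℝ_ _-ℝ_
infixl 7 _*ℝ_
infix  8 -ℝ_

_≈ℝ_ : ℝ → ℝ → Set
r ≈ℝ s = ∀ ε → 0ℚ ℚ.< ε →
  ∃ λ N → ∀ n → N ℕ.≤ n → ∣ seq r n ℚ.- seq s n ∣ ℚ.< ε

Positive : ℝ → Set
Positive r = ∃ λ ε → 0ℚ ℚ.< ε × ∃ λ N → ∀ n → N ℕ.≤ n → ε ℚ.≤ seq r n

module CauchyLemmas where

  const-cauchy : ∀ p → Cauchy (λ _ → p)
  const-cauchy p ε 0<ε = 0 , λ _ _ _ _ →
    subst (ℚ._< ε) (cong ∣_∣ (sym (ℚ.+-inverseʳ p))) 0<ε

  neg-cauchy : ∀ f → Cauchy f → Cauchy (λ n → ℚ.- f n)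
  neg-cauchy f cf ε 0<ε with cf ε 0<ε
  ... | N , h = N , λ m n N≤m N≤n → subst (ℚ._< ε) (eq (f m) (f n)) (h m n N≤m N≤n)
    where
    open +-*-Solver
    eq : ∀ p q → ∣ p ℚ.- q ∣ ≡ ∣ ℚ.- p ℚ.- ℚ.- q ∣
    eq p q = trans (sym (ℚ.∣-p∣≡∣p∣ (p ℚ.- q)))
      (cong ∣_∣ (solveℚ 2 (λ p q → :- (p :- q) := :- p :- :- q) (just _) p q))

  +-cauchy : ∀ f g → Cauchy f → Cauchy g → Cauchy (λ n → f n ℚ.+ g n)
  +-cauchy f g cf cg ε 0<ε with quotient 0<ε (+-pos 0<1 0<1)
  ... | δ , 0<δ , 2δ≡ε with cf δ 0<δ | cg δ 0<δ
  ... | M , hf | N , hg = M ⊔ N , λ m n p q → begin-strict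
    ∣ (f m ℚ.+ g m) ℚ.- (f n ℚ.+ g n) ∣
      ≡⟨ cong ∣_∣ (solveℚ 4 (λ a b c d → (a :+ b) :- (c :+ d) := (a :- c) :+ (b :- d)) (just _) (f m) (g m) (f n) (g n)) ⟩
    ∣ (f m ℚ.- f n) ℚ.+ (g m ℚ.- g n) ∣
      ≤⟨ ℚ.∣p+q∣≤∣p∣+∣q∣ (f m ℚ.- f n) (g m ℚ.- g n) ⟩
    ∣ f m ℚ.- f n ∣ ℚ.+ ∣ g m ℚ.- g n ∣
      <⟨ ℚ.+-mono-< (hf m n (≤⊔ˡ p) (≤⊔ˡ q)) (hg m n (≤⊔ʳ {M} p) (≤⊔ʳ {M} q)) ⟩
    δ ℚ.+ δ
      ≡⟨ cong₂ ℚ._+_ (ℚ.*-identityˡ δ) (ℚ.*-identityˡ δ) ⟨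
    1ℚ ℚ.* δ ℚ.+ 1ℚ ℚ.* δ
      ≡⟨ ℚ.*-distribʳ-+ δ 1ℚ 1ℚ ⟨
    (1ℚ ℚ.+ 1ℚ) ℚ.* δ
      ≡⟨ 2δ≡ε ⟩
    ε ∎
    where
    open ℚ.≤-Reasoning
    open +-*-Solver

  eventually-bounded : ∀ f → Cauchy f →
    ∃ λ B → 0ℚ ℚ.< B × ∃ λ N → ∀ n → N ℕ.≤ n → ∣ f n ∣ ℚ.≤ B
  eventually-bounded f cf with cf 1ℚ 0<1
  ... | N , h = 1ℚ ℚ.+ ∣ f N ∣ , ℚ.+-mono-<-≤ 0<1 (ℚ.0≤∣p∣ (f N)) , N , λ n N≤n → begin
    ∣ f n ∣
      ≡⟨ cong ∣_∣ (solveℚ 2 (λ a b → a := (a :- b) :+ b) (just _) (f n) (f N)) ⟩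
    ∣ (f n ℚ.- f N) ℚ.+ f N ∣
      ≤⟨ ℚ.∣p+q∣≤∣p∣+∣q∣ (f n ℚ.- f N) (f N) ⟩
    ∣ f n ℚ.- f N ∣ ℚ.+ ∣ f N ∣
      ≤⟨ ℚ.+-monoˡ-≤ ∣ f N ∣ (ℚ.<⇒≤ (h n N N≤n ℕ.≤-refl)) ⟩
    1ℚ ℚ.+ ∣ f N ∣ ∎
    where
    open ℚ.≤-Reasoning
    open +-*-Solver

  *-cauchy : ∀ f g → Cauchy f → Cauchy g → Cauchy (λ n → f n ℚ.* g n)
  *-cauchy f g cf cg ε 0<ε =
    let B , 0<B , N₁ , hB = eventually-bounded f cf
        C , 0<C , N₂ , hC = eventually-bounded g cg
        δ , 0<δ , eq      = quotient 0<ε (+-pos 0<B 0<C)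
        N₃ , hf           = cf δ 0<δ
        N₄ , hg           = cg δ 0<δ
    in (N₁ ⊔ N₂) ⊔ (N₃ ⊔ N₄) , λ m n p q →
    subst (∣ f m ℚ.* g m ℚ.- f n ℚ.* g n ∣ ℚ.<_) eq
      (distance-* (f m) (g m) (f n) (g n) 0<B 0<C
        (hB m (≤⊔ˡ (≤⊔ˡ p))) (hC n (≤⊔ʳ {N₁} (≤⊔ˡ q)))
        (hf m n (≤⊔ˡ (≤⊔ʳ {N₁ ⊔ N₂} p)) (≤⊔ˡ (≤⊔ʳ {N₁ ⊔ N₂} q)))
        (hg m n (≤⊔ʳ {N₃} (≤⊔ʳ {N₁ ⊔ N₂} p)) (≤⊔ʳ {N₃} (≤⊔ʳ {N₁ ⊔ N₂} q))))

  inv-cauchy : ∀ r → Positive r → Cauchy (λ n → inv (seq r n))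
  inv-cauchy (mkℝ f cf) (η , 0<η , N₁ , hη) ε 0<ε =
    let δ , 0<δ , eq = quotient 0<ε (*-pos (inv-pos 0<η) (inv-pos 0<η))
        N₂ , hf      = cf δ 0<δ
    in N₁ ⊔ N₂ , λ m n p q →
    subst (∣ inv (f m) ℚ.- inv (f n) ∣ ℚ.<_) eq
      (distance-inv (f m) (f n) 0<η (hη m (≤⊔ˡ p)) (hη n (≤⊔ˡ q))
        (hf n m (≤⊔ʳ {N₁} q) (≤⊔ʳ {N₁} p)))

open CauchyLemmas

fromℚ : ℚ → ℝ
fromℚ p = mkℝ (λ _ → p) (const-cauchy p)

0ℝ 1ℝ : ℝ
0ℝ = fromℚ 0ℚ
1ℝ = fromℚ 1ℚ

_+ℝ_ _*ℝ_ : ℝ → ℝ → ℝ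
mkℝ f cf +ℝ mkℝ g cg = mkℝ (λ n → f n ℚ.+ g n) (+-cauchy f g cf cg)
mkℝ f cf *ℝ mkℝ g cg = mkℝ (λ n → f n ℚ.* g n) (*-cauchy f g cf cg)

-ℝ_ : ℝ → ℝ
-ℝ mkℝ f cf = mkℝ (λ n → ℚ.- f n) (neg-cauchy f cf)

_-ℝ_ : ℝ → ℝ → ℝ
r -ℝ s = r +ℝ (-ℝ s)

invℝ : (r : ℝ) → Positive r → ℝ
invℝ r r>0 = mkℝ (λ n → inv (seq r n)) (inv-cauchy r r>0)

infix  4 _≈_ _≢0
infixl 6 _+_
infixl 7 _*_ _/_⟨_⟩
infix  8 -_

record ℂ : Set where
  constructor _+i_
  field
    re : ℝ
    im : ℝ

open ℂ public

_≈_ : ℂ → ℂ → Set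
z ≈ w = re z ≈ℝ re w × im z ≈ℝ im w

0ℂ 1ℂ : ℂ
0ℂ = 0ℝ +i 0ℝ
1ℂ = 1ℝ +i 0ℝ

_+_ _*_ : ℂ → ℂ → ℂ
(a +i b) + (c +i d) = (a +ℝ c) +i (b +ℝ d)
(a +i b) * (c +i d) = (a *ℝ c -ℝ b *ℝ d) +i (a *ℝ d +ℝ b *ℝ c)

-_ : ℂ → ℂ
- (a +i b) = (-ℝ a) +i (-ℝ b)

2ℂ : ℂ
2ℂ = 1ℂ + 1ℂ

normSq : ℂ → ℝ
normSq (a +i b) = a *ℝ a +ℝ b *ℝ b

-- Being nonzero is read positively, as |z|² > 0; this is what makes z
-- invertible.  Classically it is the same as ¬ (z ≈ 0ℂ).
_≢0 : ℂ → Set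
z ≢0 = Positive (normSq z)

invℂ : (z : ℂ) → z ≢0 → ℂ
invℂ z@(a +i b) z≢0 = (a *ℝ invℝ (normSq z) z≢0) +i (-ℝ b *ℝ invℝ (normSq z) z≢0)

_/_⟨_⟩ : ℂ → (w : ℂ) → w ≢0 → ℂ
z / w ⟨ w≢0 ⟩ = z * invℂ w w≢0

*-≢0 : ∀ {z w} → z ≢0 → w ≢0 → z * w ≢0
*-≢0 {a +i b} {c +i d} (ε , 0<ε , M , hz) (δ , 0<δ , N , hw) =
  ε ℚ.* δ , *-pos 0<ε 0<δ , M ⊔ N , λ n p → subst (ε ℚ.* δ ℚ.≤_)
    (brahmagupta (seq a n) (seq b n) (seq c n) (seq d n))
    (*-mono-≤ (ℚ.<⇒≤ 0<ε) (hz n (≤⊔ˡ p)) (ℚ.<⇒≤ 0<δ) (hw n (≤⊔ʳ {M} p)))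
  where
  open +-*-Solver
  brahmagupta : ∀ a b c d →
    (a ℚ.* a ℚ.+ b ℚ.* b) ℚ.* (c ℚ.* c ℚ.+ d ℚ.* d) ≡
    (a ℚ.* c ℚ.+ ℚ.- (b ℚ.* d)) ℚ.* (a ℚ.* c ℚ.+ ℚ.- (b ℚ.* d)) ℚ.+
    (a ℚ.* d ℚ.+ b ℚ.* c) ℚ.* (a ℚ.* d ℚ.+ b ℚ.* c)
  brahmagupta = solveℚ 4 (λ a b c d →
    (a :* a :+ b :* b) :* (c :* c :+ d :* d) :=
    (a :* c :+ :- (b :* d)) :* (a :* c :+ :- (b :* d)) :+
    (a :* d :+ b :* c) :* (a :* d :+ b :* c)) (just _)

*-inverseʳ : ∀ z (z≢0 : z ≢0) → z * invℂ z z≢0 ≈ 1ℂ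
*-inverseʳ (mkℝ a _ +i mkℝ b _) (η , 0<η , N , hη) =
  (λ ε 0<ε → N , λ n p → close 0<ε (trans (re-eq (a n) (b n) _) (*-inv (ℚ.<-≤-trans 0<η (hη n p))))) ,
  (λ ε 0<ε → N , λ n p → close 0<ε (im-eq (a n) (b n) _))
  where
  open +-*-Solver
  close : ∀ {ε p q} → 0ℚ ℚ.< ε → p ≡ q → ∣ p ℚ.- q ∣ ℚ.< ε
  close {ε} {p} 0<ε refl = subst (ℚ._< ε) (cong ∣_∣ (sym (ℚ.+-inverseʳ p))) 0<ε
  re-eq : ∀ a b i → a ℚ.* (a ℚ.* i) ℚ.+ ℚ.- (b ℚ.* (ℚ.- b ℚ.* i)) ≡ (a ℚ.* a ℚ.+ b ℚ.* b) ℚ.* i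
  re-eq = solveℚ 3 (λ a b i → a :* (a :* i) :+ :- (b :* (:- b :* i)) := (a :* a :+ b :* b) :* i) (just _)
  im-eq : ∀ a b i → a ℚ.* (ℚ.- b ℚ.* i) ℚ.+ b ℚ.* (a ℚ.* i) ≡ 0ℚ
  im-eq = solveℚ 3 (λ a b i → a :* (:- b :* i) :+ b :* (a :* i) := con 0ℚ) (just _)

⟦_⟧ : Sign → ℂ
⟦ Sign.+ ⟧ = 1ℂ
⟦ Sign.- ⟧ = - 1ℂ

-- An element of L is an integer point or the centre of a unit square; with
-- integers a, b, c,
--   vertex a b c = (a , b , c)
--   yz     a b c = (a , b + ½ , c + ½)
--   xz     a b c = (a + ½ , b , c + ½)
--   xy     a b c = (a + ½ , b + ½ , c)
-- These are exactly the half-integer points whose coordinate sum is an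
-- integer, since such a point has either no or two non-integer coordinates.
data L : Set where
  vertex yz xz xy : (a b c : ℤ) → L

-- zijk is the value of x at (a , b , c) + (i , j , k).
module Cube (x : L → ℂ) (a b c : ℤ) where

  z000 z100 z010 z001 z011 z101 z110 z111 : ℂ
  z000 = x (vertex a b c)
  z100 = x (vertex (sucℤ a) b c)
  z010 = x (vertex a (sucℤ b) c)
  z001 = x (vertex a b (sucℤ c))
  z011 = x (vertex a (sucℤ b) (sucℤ c))
  z101 = x (vertex (sucℤ a) b (sucℤ c))
  z110 = x (vertex (sucℤ a) (sucℤ b) c)
  z111 = x (vertex (sucℤ a) (sucℤ b) (sucℤ c))

  z0½½ z½0½ z½½0 z1½½ z½1½ z½½1 : ℂ
  z0½½ = x (yz a b c)
  z½0½ = x (xz a b c)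
  z½½0 = x (xy a b c)
  z1½½ = x (yz (sucℤ a) b c)
  z½1½ = x (xz a (sucℤ b) c)
  z½½1 = x (xy a b (sucℤ c))

  A : ℂ
  A = 2ℂ * z100 * z010 * z001 + z000 * (z100 * z011 + z010 * z101 + z001 * z110)

record KHexahedron (x : L → ℂ) : Set where
  field
    vertex≢0 : ∀ a b c → x (vertex a b c) ≢0

    yz-square : ∀ a b c → let open Cube x a b c in
      z0½½ * z0½½ ≈ z000 * z011 + z010 * z001
    xz-square : ∀ a b c → let open Cube x a b c in
      z½0½ * z½0½ ≈ z000 * z101 + z100 * z001
    xy-square : ∀ a b c → let open Cube x a b c in
      z½½0 * z½½0 ≈ z000 * z110 + z100 * z010

    yz-step : ∀ a b c → let open Cube x a b c in
      z1½½ ≈ (z½0½ * z½½0 + z0½½ * z100) / z000 ⟨ vertex≢0 a b c ⟩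
    xz-step : ∀ a b c → let open Cube x a b c in
      z½1½ ≈ (z0½½ * z½½0 + z½0½ * z010) / z000 ⟨ vertex≢0 a b c ⟩
    xy-step : ∀ a b c → let open Cube x a b c in
      z½½1 ≈ (z0½½ * z½0½ + z½½0 * z001) / z000 ⟨ vertex≢0 a b c ⟩
    vertex-step : ∀ a b c → let open Cube x a b c in
      z111 ≈ (A + 2ℂ * z0½½ * z½0½ * z½½0)
        / (z000 * z000) ⟨ *-≢0 {z000} {z000} (vertex≢0 a b c) (vertex≢0 a b c) ⟩

resign : (α β γ : ℤ → Sign) → (L → ℂ) → (L → ℂ)
resign α β γ x (vertex a b c) = x (vertex a b c)
resign α β γ x (yz a b c)     = ⟦ β b ⟧ * ⟦ γ c ⟧ * x (yz a b c)
resign α β γ x (xz a b c)     = ⟦ α a ⟧ * ⟦ γ c ⟧ * x (xz a b c)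
resign α β γ x (xy a b c)     = ⟦ α a ⟧ * ⟦ β b ⟧ * x (xy a b c)

{-# OPTIONS --safe #-}

-- (a) The sign of each face is the product of the signs of the other two kinds
-- of faces at the same cube, so the squares, the three face steps and the
-- product of three faces in the vertex step all absorb the signs.
--
-- (b) Faces of x and y have equal squares, so they differ by a sign; it can be
-- decided constructively because |y - x|² + |y + x|² ≥ |x|² > 0.  As nothing
-- vanishes, a face step x' z = p q + r g forces the sign of x' to be that of r
-- and the product of those of p and q.  So the signs are functions T(b,c),
-- U(a,c), V(a,b) with T(b,c) = U(a,c) V(a,b), and α(a) = V(a,0) V(0,0),
-- β(b) = V(0,b), γ(c) = U(0,c) solve the problem.

module Submission where

open import Defs
open import Algebra.Bundles using (CommutativeRing)
open import Algebra.Core using (Op₁; Op₂)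
open import Algebra.Structures using (IsCommutativeRing)
import Algebra.Properties.Ring as RingProperties
import Algebra.Solver.Ring.NaturalCoefficients.Default as SemiringSolver
open import Data.Integer.Base as ℤ using (ℤ; -[1+_]; 0ℤ) renaming (suc to sucℤ)
open import Data.Maybe.Relation.Unary.Any using (just)
open import Data.Nat.Base as ℕ using (_⊔_)
import Data.Nat.Properties as ℕ
open import Data.Product.Base using (_×_; _,_; ∃; ∃-syntax; Σ-syntax; proj₁; proj₂)
open import Data.Rational.Base as ℚ using (0ℚ; 1ℚ; ∣_∣)
import Data.Rational.Properties as ℚ
open import Data.Rational.Solver using (module +-*-Solver)
open import Data.Sign.Base as Sign using (Sign)
import Data.Sign.Properties as Sign
open import Data.Sum.Base using (_⊎_; inj₁; inj₂)
open import Level using (0ℓ)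
open import Relation.Binary.PropositionalEquality as ≡ using (_≡_; cong; cong₂; subst)
open import Relation.Binary.Core using (Rel)
import Relation.Binary.Reasoning.Setoid as ≈-Reasoning
open import Relation.Nullary.Decidable using (Dec; yes; no; toWitness)
open import Relation.Nullary.Negation using (¬_; contradiction)

open RationalLemmas
open CauchyLemmas

-- Equality of Cauchy reals as a congruence.

≡⇒≈ℝ : ∀ r s → (∀ n → seq r n ≡ seq s n) → r ≈ℝ s
≡⇒≈ℝ r s r≡s ε 0<ε = 0 , λ n _ →
  subst (ℚ._< ε) (≡.sym (cong ∣_∣ (≡.trans (cong (ℚ._- seq s n) (r≡s n)) (ℚ.+-inverseʳ (seq s n))))) 0<ε

∣p-q∣≡∣q-p∣ : ∀ p q → ∣ p ℚ.- q ∣ ≡ ∣ q ℚ.- p ∣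
∣p-q∣≡∣q-p∣ p q = ≡.trans (≡.sym (ℚ.∣-p∣≡∣p∣ (p ℚ.- q)))
  (cong ∣_∣ (solveℚ 2 (λ p q → :- (p :- q) := q :- p) (just _) p q))
  where open +-*-Solver

≈ℝ-sym : ∀ r s → r ≈ℝ s → s ≈ℝ r
≈ℝ-sym r s r≈s ε 0<ε with r≈s ε 0<ε
... | N , h = N , λ n p → subst (ℚ._< ε) (∣p-q∣≡∣q-p∣ (seq r n) (seq s n)) (h n p)

half : ∀ {ε} → 0ℚ ℚ.< ε → ∃ λ δ → 0ℚ ℚ.< δ × δ ℚ.+ δ ≡ ε
half 0<ε with quotient 0<ε (+-pos 0<1 0<1)
... | δ , 0<δ , eq = δ , 0<δ ,
  ≡.trans (solveℚ 1 (λ d → d :+ d := (con 1ℚ :+ con 1ℚ) :* d) (just _) δ) eq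
  where open +-*-Solver

∣p+q∣<δ+δ : ∀ p q {δ} → ∣ p ∣ ℚ.< δ → ∣ q ∣ ℚ.< δ → ∣ p ℚ.+ q ∣ ℚ.< δ ℚ.+ δ
∣p+q∣<δ+δ p q hp hq = ℚ.≤-<-trans (ℚ.∣p+q∣≤∣p∣+∣q∣ p q) (ℚ.+-mono-< hp hq)

≈ℝ-trans : ∀ r s t → r ≈ℝ s → s ≈ℝ t → r ≈ℝ t
≈ℝ-trans r s t r≈s s≈t ε 0<ε =
  let δ , 0<δ , eq = half 0<ε
      M , hM = r≈s δ 0<δ
      N , hN = s≈t δ 0<δ
  in M ⊔ N , λ n p → ≡.subst₂ ℚ._<_
    (cong ∣_∣ (telescope (seq r n) (seq s n) (seq t n))) eq
    (∣p+q∣<δ+δ (seq r n ℚ.- seq s n) (seq s n ℚ.- seq t n) (hM n (≤⊔ˡ p)) (hN n (≤⊔ʳ {M} p)))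
  where
  open +-*-Solver
  telescope : ∀ p q r → (p ℚ.- q) ℚ.+ (q ℚ.- r) ≡ p ℚ.- r
  telescope = solveℚ 3 (λ p q r → (p :- q) :+ (q :- r) := p :- r) (just _)

+ℝ-cong : ∀ r s t u → r ≈ℝ s → t ≈ℝ u → r +ℝ t ≈ℝ s +ℝ u
+ℝ-cong r s t u r≈s t≈u ε 0<ε =
  let δ , 0<δ , eq = half 0<ε
      M , hM = r≈s δ 0<δ
      N , hN = t≈u δ 0<δ
  in M ⊔ N , λ n p → ≡.subst₂ ℚ._<_
    (cong ∣_∣ (regroup (seq r n) (seq s n) (seq t n) (seq u n))) eq
    (∣p+q∣<δ+δ (seq r n ℚ.- seq s n) (seq t n ℚ.- seq u n) (hM n (≤⊔ˡ p)) (hN n (≤⊔ʳ {M} p)))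
  where
  open +-*-Solver
  regroup : ∀ r s t u → (r ℚ.- s) ℚ.+ (t ℚ.- u) ≡ (r ℚ.+ t) ℚ.- (s ℚ.+ u)
  regroup = solveℚ 4 (λ r s t u → (r :- s) :+ (t :- u) := (r :+ t) :- (s :+ u)) (just _)

-ℝ-cong : ∀ r s → r ≈ℝ s → -ℝ r ≈ℝ -ℝ s
-ℝ-cong r s r≈s ε 0<ε with r≈s ε 0<ε
... | N , h = N , λ n p → subst (ℚ._< ε) (negate (seq r n) (seq s n)) (h n p)
  where
  open +-*-Solver
  negate : ∀ p q → ∣ p ℚ.- q ∣ ≡ ∣ ℚ.- p ℚ.- ℚ.- q ∣
  negate p q = ≡.trans (≡.sym (ℚ.∣-p∣≡∣p∣ (p ℚ.- q)))
    (cong ∣_∣ (solveℚ 2 (λ p q → :- (p :- q) := :- p :- :- q) (just _) p q))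

*ℝ-cong : ∀ r s t u → r ≈ℝ s → t ≈ℝ u → r *ℝ t ≈ℝ s *ℝ u
*ℝ-cong r s t u r≈s t≈u ε 0<ε =
  -- The bounds are taken on `r` and `u` because these are the factors that remain in
  -- `rt - su = r (t - u) + u (r - s)`; then `δ = ε / (B + C)`.
  let B , 0<B , N₁ , hB = eventually-bounded (seq r) (cauchy r)
      C , 0<C , N₂ , hC = eventually-bounded (seq u) (cauchy u)
      δ , 0<δ , eq      = quotient 0<ε (+-pos 0<B 0<C)
      N₃ , hr           = r≈s δ 0<δ
      N₄ , ht           = t≈u δ 0<δ
  in (N₁ ⊔ N₂) ⊔ (N₃ ⊔ N₄) , λ n p →
  subst (∣ seq r n ℚ.* seq t n ℚ.- seq s n ℚ.* seq u n ∣ ℚ.<_) eq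
    (distance-* (seq r n) (seq t n) (seq s n) (seq u n) 0<B 0<C
      (hB n (≤⊔ˡ (≤⊔ˡ p))) (hC n (≤⊔ʳ {N₁} (≤⊔ˡ p)))
      (hr n (≤⊔ˡ (≤⊔ʳ {N₁ ⊔ N₂} p))) (ht n (≤⊔ʳ {N₃} (≤⊔ʳ {N₁ ⊔ N₂} p))))

-- The commutative ring of complex numbers.

-- _≈_ unfolds to a statement about sequences, from which Agda cannot recover
-- the two complex numbers; wrapping it in a record makes them inferable.
infix 4 _≋_
record _≋_ (z w : ℂ) : Set where
  constructor wrap
  field unwrap : z ≈ w
open _≋_

≡⇒≋ : ∀ {z w} → (∀ n → seq (re z) n ≡ seq (re w) n) →
      (∀ n → seq (im z) n ≡ seq (im w) n) → z ≋ w
≡⇒≋ {z} {w} hr hi = wrap (≡⇒≈ℝ (re z) (re w) hr , ≡⇒≈ℝ (im z) (im w) hi)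

≋-trans : ∀ {z w v} → z ≋ w → w ≋ v → z ≋ v
≋-trans {z} {w} {v} (wrap (p , q)) (wrap (r , s)) =
  wrap (≈ℝ-trans (re z) (re w) (re v) p r , ≈ℝ-trans (im z) (im w) (im v) q s)

+-cong : ∀ {z w z′ w′} → z ≋ w → z′ ≋ w′ → z + z′ ≋ w + w′
+-cong {z} {w} {z′} {w′} (wrap (p , q)) (wrap (r , s)) =
  wrap (+ℝ-cong (re z) (re w) (re z′) (re w′) p r , +ℝ-cong (im z) (im w) (im z′) (im w′) q s)

*-cong : ∀ {z w z′ w′} → z ≋ w → z′ ≋ w′ → z * z′ ≋ w * w′
*-cong {a +i b} {c +i d} {a′ +i b′} {c′ +i d′} (wrap (p , q)) (wrap (r , s)) = wrap
  ( +ℝ-cong (a *ℝ a′) (c *ℝ c′) (-ℝ (b *ℝ b′)) (-ℝ (d *ℝ d′))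
      (*ℝ-cong a c a′ c′ p r) (-ℝ-cong (b *ℝ b′) (d *ℝ d′) (*ℝ-cong b d b′ d′ q s))
  , +ℝ-cong (a *ℝ b′) (c *ℝ d′) (b *ℝ a′) (d *ℝ c′)
      (*ℝ-cong a c b′ d′ p s) (*ℝ-cong b d a′ c′ q r))

-- Apart from symmetry, transitivity and the congruences, which need epsilons, every law holds term
-- by term, as a rational identity in the real and imaginary parts.
ℂ-isCommutativeRing : IsCommutativeRing _≋_ _+_ _*_ -_ 0ℂ 1ℂ
ℂ-isCommutativeRing = record
  { isRing = record
    { +-isAbelianGroup = record
      { isGroup = record
        { isMonoid = record
          { isSemigroup = record
            { isMagma = record
              { isEquivalence = record
                { refl = ≡⇒≋ (λ _ → ≡.refl) (λ _ → ≡.refl)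
                ; sym = λ { {z} {w} (wrap (p , q)) → wrap (≈ℝ-sym (re z) (re w) p , ≈ℝ-sym (im z) (im w) q) }
                ; trans = ≋-trans
                }
              ; ∙-cong = +-cong
              }
            ; assoc = λ z w v → ≡⇒≋ (λ n → ℚ.+-assoc (seq (re z) n) (seq (re w) n) (seq (re v) n))
                                       (λ n → ℚ.+-assoc (seq (im z) n) (seq (im w) n) (seq (im v) n))
            }
          ; identity = (λ z → ≡⇒≋ (λ _ → ℚ.+-identityˡ _) (λ _ → ℚ.+-identityˡ _))
                     , (λ z → ≡⇒≋ (λ _ → ℚ.+-identityʳ _) (λ _ → ℚ.+-identityʳ _))
          }
        ; inverse = (λ z → ≡⇒≋ (λ n → ℚ.+-inverseˡ (seq (re z) n)) (λ n → ℚ.+-inverseˡ (seq (im z) n)))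
                  , (λ z → ≡⇒≋ (λ n → ℚ.+-inverseʳ (seq (re z) n)) (λ n → ℚ.+-inverseʳ (seq (im z) n)))
        ; ⁻¹-cong = λ { {z} {w} (wrap (p , q)) → wrap (-ℝ-cong (re z) (re w) p , -ℝ-cong (im z) (im w) q) }
        }
      ; comm = λ z w → ≡⇒≋ (λ n → ℚ.+-comm (seq (re z) n) (seq (re w) n))
                                (λ n → ℚ.+-comm (seq (im z) n) (seq (im w) n))
      }
    ; *-cong = *-cong
    ; *-assoc = λ { (a +i b) (c +i d) (e +i f) → ≡⇒≋
        (λ n → solveℚ 6 (λ a b c d e f →
           (a :* c :+ :- (b :* d)) :* e :+ :- ((a :* d :+ b :* c) :* f) :=
           a :* (c :* e :+ :- (d :* f)) :+ :- (b :* (c :* f :+ d :* e))) (just _)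
           (seq a n) (seq b n) (seq c n) (seq d n) (seq e n) (seq f n))
        (λ n → solveℚ 6 (λ a b c d e f →
           (a :* c :+ :- (b :* d)) :* f :+ (a :* d :+ b :* c) :* e :=
           a :* (c :* f :+ d :* e) :+ b :* (c :* e :+ :- (d :* f))) (just _)
           (seq a n) (seq b n) (seq c n) (seq d n) (seq e n) (seq f n)) }
    ; *-identity =
        (λ { (a +i b) → ≡⇒≋
          (λ n → solveℚ 2 (λ a b → con 1ℚ :* a :+ :- (con 0ℚ :* b) := a) (just _) (seq a n) (seq b n))
          (λ n → solveℚ 2 (λ a b → con 1ℚ :* b :+ con 0ℚ :* a := b) (just _) (seq a n) (seq b n)) })
      , (λ { (a +i b) → ≡⇒≋
          (λ n → solveℚ 2 (λ a b → a :* con 1ℚ :+ :- (b :* con 0ℚ) := a) (just _) (seq a n) (seq b n))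
          (λ n → solveℚ 2 (λ a b → a :* con 0ℚ :+ b :* con 1ℚ := b) (just _) (seq a n) (seq b n)) })
    ; distrib =
        (λ { (a +i b) (c +i d) (e +i f) → ≡⇒≋
          (λ n → solveℚ 6 (λ a b c d e f →
             a :* (c :+ e) :+ :- (b :* (d :+ f)) :=
             (a :* c :+ :- (b :* d)) :+ (a :* e :+ :- (b :* f))) (just _)
             (seq a n) (seq b n) (seq c n) (seq d n) (seq e n) (seq f n))
          (λ n → solveℚ 6 (λ a b c d e f →
             a :* (d :+ f) :+ b :* (c :+ e) :=
             (a :* d :+ b :* c) :+ (a :* f :+ b :* e)) (just _)
             (seq a n) (seq b n) (seq c n) (seq d n) (seq e n) (seq f n)) })
      , (λ { (a +i b) (c +i d) (e +i f) → ≡⇒≋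
          (λ n → solveℚ 6 (λ a b c d e f →
             (c :+ e) :* a :+ :- ((d :+ f) :* b) :=
             (c :* a :+ :- (d :* b)) :+ (e :* a :+ :- (f :* b))) (just _)
             (seq a n) (seq b n) (seq c n) (seq d n) (seq e n) (seq f n))
          (λ n → solveℚ 6 (λ a b c d e f →
             (c :+ e) :* b :+ (d :+ f) :* a :=
             (c :* b :+ d :* a) :+ (e :* b :+ f :* a)) (just _)
             (seq a n) (seq b n) (seq c n) (seq d n) (seq e n) (seq f n)) })
    }
  ; *-comm = λ { (a +i b) (c +i d) → ≡⇒≋
      (λ n → solveℚ 4 (λ a b c d →
         a :* c :+ :- (b :* d) := c :* a :+ :- (d :* b)) (just _)
         (seq a n) (seq b n) (seq c n) (seq d n))
      (λ n → solveℚ 4 (λ a b c d →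
         a :* d :+ b :* c := c :* b :+ d :* a) (just _)
         (seq a n) (seq b n) (seq c n) (seq d n)) }
  }
  where open +-*-Solver

-- Positivity and the constructive choice of a nonzero factor.

-- After `N` the sequence strays from its value there by less than `δ`, so half of the margin `2δ`
-- survives. A single rational comparison thus certifies positivity.
Positive-bound : ∀ r N {δ} → 0ℚ ℚ.< δ →
  (∀ m n → N ℕ.≤ m → N ℕ.≤ n → ∣ seq r m ℚ.- seq r n ∣ ℚ.< δ) →
  δ ℚ.+ δ ℚ.≤ seq r N → Positive r
Positive-bound r N {δ} 0<δ h 2δ≤r = δ , 0<δ , N , λ n N≤n → begin
  δ                                          ≡⟨ solveℚ 1 (λ d → d := (d :+ d) :- d) (just _) δ ⟩
  (δ ℚ.+ δ) ℚ.- δ                            ≤⟨ ℚ.+-mono-≤ 2δ≤r (ℚ.neg-antimono-≤ (ℚ.<⇒≤ (h N n ℕ.≤-refl N≤n))) ⟩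
  seq r N ℚ.- ∣ seq r N ℚ.- seq r n ∣        ≤⟨ ℚ.+-monoʳ-≤ (seq r N) (ℚ.neg-antimono-≤ (p≤∣p∣ (seq r N ℚ.- seq r n))) ⟩
  seq r N ℚ.- (seq r N ℚ.- seq r n)          ≡⟨ solveℚ 2 (λ p q → p :- (p :- q) := q) (just _) (seq r N) (seq r n) ⟩
  seq r n                                    ∎
  where
  open ℚ.≤-Reasoning
  open +-*-Solver
  p≤∣p∣ : ∀ p → p ℚ.≤ ∣ p ∣
  p≤∣p∣ p with ℚ.≤-total 0ℚ p
  ... | inj₁ 0≤p = ℚ.≤-reflexive (≡.sym (ℚ.0≤p⇒∣p∣≡p 0≤p))
  ... | inj₂ p≤0 = ℚ.≤-trans p≤0 (ℚ.0≤∣p∣ p)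

-- Decided by comparing one sufficiently late rational approximation of r
-- with half of the lower bound for r + s.
Positive-split : ∀ r s → Positive (r +ℝ s) → Positive r ⊎ Positive s
Positive-split r s (ε , 0<ε , M , hM) = decide (δ ℚ.+ δ ℚ.≤? seq r N)
  where
  -- Halving twice makes `δ` a quarter of `ε`: if `r` misses the threshold `2δ` at `N`, at least
  -- `ε - 2δ = 2δ` is left for `s`, and either way `Positive-bound` applies.
  η-half = half 0<ε
  δ-half = half (proj₁ (proj₂ η-half))
  δ = proj₁ δ-half
  0<δ = proj₁ (proj₂ δ-half)
  4δ≡ε : (δ ℚ.+ δ) ℚ.+ (δ ℚ.+ δ) ≡ ε
  4δ≡ε = ≡.trans (cong (λ p → p ℚ.+ p) (proj₂ (proj₂ δ-half))) (proj₂ (proj₂ η-half))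
  N₁ = proj₁ (cauchy r δ 0<δ)
  N₂ = proj₁ (cauchy s δ 0<δ)
  N = M ⊔ (N₁ ⊔ N₂)
  M≤N : M ℕ.≤ N
  M≤N = ≤⊔ˡ {M} {N₁ ⊔ N₂} ℕ.≤-refl
  N₁≤N : N₁ ℕ.≤ N
  N₁≤N = ≤⊔ˡ {N₁} {N₂} (≤⊔ʳ {M} ℕ.≤-refl)
  N₂≤N : N₂ ℕ.≤ N
  N₂≤N = ≤⊔ʳ {N₁} {N₂} (≤⊔ʳ {M} ℕ.≤-refl)
  open ℚ.≤-Reasoning
  open +-*-Solver
  decide : Dec (δ ℚ.+ δ ℚ.≤ seq r N) → Positive r ⊎ Positive s
  decide (yes 2δ≤r) = inj₁ (Positive-bound r N 0<δ
    (λ m n p q → proj₂ (cauchy r δ 0<δ) m n (ℕ.≤-trans N₁≤N p) (ℕ.≤-trans N₁≤N q)) 2δ≤r)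
  decide (no 2δ≰r) = inj₂ (Positive-bound s N 0<δ
    (λ m n p q → proj₂ (cauchy s δ 0<δ) m n (ℕ.≤-trans N₂≤N p) (ℕ.≤-trans N₂≤N q)) (begin
      δ ℚ.+ δ                                    ≡⟨ solveℚ 1 (λ d → d :+ d := ((d :+ d) :+ (d :+ d)) :- (d :+ d)) (just _) δ ⟩
      ((δ ℚ.+ δ) ℚ.+ (δ ℚ.+ δ)) ℚ.- (δ ℚ.+ δ)    ≡⟨ cong (ℚ._- (δ ℚ.+ δ)) 4δ≡ε ⟩
      ε ℚ.- (δ ℚ.+ δ)                            ≤⟨ ℚ.+-mono-≤ (hM N M≤N) (ℚ.neg-antimono-≤ (ℚ.<⇒≤ (ℚ.≰⇒> 2δ≰r))) ⟩
      (seq r N ℚ.+ seq s N) ℚ.- seq r N          ≡⟨ solveℚ 2 (λ p q → (p :+ q) :- p := q) (just _) (seq r N) (seq s N) ⟩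
      seq s N                                    ∎))

-- |z - w|² + |z + w|² = 2 |z|² + 2 |w|² ≥ |w|²
parallelogram-positive : ∀ z w → w ≢0 → Positive (normSq (z + - w) +ℝ normSq (z + w))
parallelogram-positive (a +i b) (c +i d) (ε , 0<ε , N , h) = ε , 0<ε , N , λ n p →
  subst (ε ℚ.≤_) (≡.sym (law (seq a n) (seq b n) (seq c n) (seq d n)))
    (ℚ.≤-trans (h n p) (p≤p+q _ _
      (+-nonNeg (+-nonNeg (+-nonNeg (square≥0 (seq c n)) (square≥0 (seq d n)))
                          (+-nonNeg (square≥0 (seq a n)) (square≥0 (seq b n))))
                (+-nonNeg (square≥0 (seq a n)) (square≥0 (seq b n))))))
  where
  open +-*-Solver
  law : ∀ a b c d →
    ((a ℚ.+ ℚ.- c) ℚ.* (a ℚ.+ ℚ.- c) ℚ.+ (b ℚ.+ ℚ.- d) ℚ.* (b ℚ.+ ℚ.- d)) ℚ.+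
    ((a ℚ.+ c) ℚ.* (a ℚ.+ c) ℚ.+ (b ℚ.+ d) ℚ.* (b ℚ.+ d)) ≡
    (c ℚ.* c ℚ.+ d ℚ.* d) ℚ.+
    (((c ℚ.* c ℚ.+ d ℚ.* d) ℚ.+ (a ℚ.* a ℚ.+ b ℚ.* b)) ℚ.+ (a ℚ.* a ℚ.+ b ℚ.* b))
  law = solveℚ 4 (λ a b c d →
    ((a :+ :- c) :* (a :+ :- c) :+ (b :+ :- d) :* (b :+ :- d)) :+
    ((a :+ c) :* (a :+ c) :+ (b :+ d) :* (b :+ d)) :=
    (c :* c :+ d :* d) :+
    (((c :* c :+ d :* d) :+ (a :* a :+ b :* b)) :+ (a :* a :+ b :* b))) (just _)
  +-nonNeg : ∀ {p q} → 0ℚ ℚ.≤ p → 0ℚ ℚ.≤ q → 0ℚ ℚ.≤ p ℚ.+ q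
  +-nonNeg = ℚ.+-mono-≤
  p≤p+q : ∀ p q → 0ℚ ℚ.≤ q → p ℚ.≤ p ℚ.+ q
  p≤p+q p q 0≤q = subst (ℚ._≤ p ℚ.+ q) (ℚ.+-identityʳ p) (ℚ.+-monoʳ-≤ p 0≤q)
  square≥0 : ∀ p → 0ℚ ℚ.≤ p ℚ.* p
  square≥0 p = subst (0ℚ ℚ.≤_) (∣p∣²≡p² p) (*-mono-≤ ℚ.≤-refl (ℚ.0≤∣p∣ p) ℚ.≤-refl (ℚ.0≤∣p∣ p))
    where
    ∣p∣²≡p² : ∀ p → ∣ p ∣ ℚ.* ∣ p ∣ ≡ p ℚ.* p
    ∣p∣²≡p² p with ℚ.∣p∣≡p∨∣p∣≡-p p
    ... | inj₁ eq = cong₂ ℚ._*_ eq eq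
    ... | inj₂ eq = ≡.trans (cong₂ ℚ._*_ eq eq) (solveℚ 1 (λ p → :- p :* :- p := p :* p) (just _) p)

1≄0 : ¬ (1ℂ ≋ 0ℂ)
1≄0 (wrap (1≈0 , _)) with 1≈0 1ℚ 0<1
... | N , h = ℚ.<-irrefl ≡.refl (h N ℕ.≤-refl)

s*t≡r⇒s≡t*r : ∀ s t {r} → s Sign.* t ≡ r → s ≡ t Sign.* r
s*t≡r⇒s≡t*r Sign.+ t      ≡.refl = ≡.sym (Sign.s*s≡+ t)
s*t≡r⇒s≡t*r Sign.- Sign.+ ≡.refl = ≡.refl
s*t≡r⇒s≡t*r Sign.- Sign.- ≡.refl = ≡.refl

s*t≡+⇒s≡t : ∀ s t → s Sign.* t ≡ Sign.+ → s ≡ t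
s*t≡+⇒s≡t s t h = ≡.trans (s*t≡r⇒s≡t*r s t h) (Sign.*-identityʳ t)

-- Sign changes over an abstract commutative ring.

-- Parametrised by the operations rather than by a bundle: instances are then
-- stated with the operations of ℂ themselves, and Agda need not compare them
-- with projections from a bundle by unfolding Cauchy sequences.  For the same
-- reason the lemmas that are applied to ℂ take all their arguments explicitly.
module SignTwists
  {C : Set} {_≃_ : Rel C 0ℓ} {_⊕_ _⊗_ : Op₂ C} {⊖_ : Op₁ C} {0# 1# : C}
  (isCommutativeRing : IsCommutativeRing _≃_ _⊕_ _⊗_ ⊖_ 0# 1#)
  (NonZero : C → Set) (inverse : ∀ z → NonZero z → C)
  (inverseʳ : ∀ z z≢0 → (z ⊗ inverse z z≢0) ≃ 1#)
  (⊗-nonZero : ∀ z w → NonZero z → NonZero w → NonZero (z ⊗ w))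
  (1≄0 : ¬ (1# ≃ 0#)) (2-nonZero : NonZero (1# ⊕ 1#))
  (±-nonZero : ∀ z w → NonZero w → NonZero (z ⊕ (⊖ w)) ⊎ NonZero (z ⊕ w))
  (divide : C → ∀ w → NonZero w → C)
  (divide-def : ∀ z w w≢0 → divide z w w≢0 ≃ (z ⊗ inverse w w≢0))
  (sgn : Sign → C) (sgn+ : sgn Sign.+ ≃ 1#) (sgn- : sgn Sign.- ≃ (⊖ 1#))
  where

  open IsCommutativeRing isCommutativeRing using
    ( setoid; *-identityˡ; *-identityʳ; distribˡ; distribʳ; zeroˡ; zeroʳ; +-identityˡ; -‿inverseˡ; -‿cong)
    renaming ( refl to ≃-refl; sym to ≃-sym; trans to ≃-trans; +-cong to ⊕-cong; +-congˡ to ⊕-congˡ; +-congʳ to ⊕-congʳ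
             ; *-cong to ⊗-cong; *-congʳ to ⊗-congʳ; *-congˡ to ⊗-congˡ; *-assoc to ⊗-assoc; *-comm to ⊗-comm)

  commutativeRing : CommutativeRing 0ℓ 0ℓ
  commutativeRing = record { isCommutativeRing = isCommutativeRing }

  open CommutativeRing commutativeRing using (ring; commutativeSemiring)
  open RingProperties ring using
    ( -1*x≈-x; -‿involutive; -‿distribˡ-*; -‿+-comm; +-cancelˡ; +-cancelʳ
    ; x∙y⁻¹≈ε⇒x≈y; x≈y⇒x∙y⁻¹≈ε; +-inverseʳ-unique)
  open SemiringSolver commutativeSemiring
  open ≈-Reasoning setoid

  -- A record so that Agda compares u, p and p′ instead of unfolding u * p in ℂ.
  record Scaled (u p p′ : C) : Set where
    constructor scaled
    field equation : p′ ≃ (u ⊗ p)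

  unit-* : ∀ {u} p → u ≃ 1# → (u ⊗ p) ≃ p
  unit-* p u≃1 = ≃-trans (⊗-congʳ u≃1) (*-identityˡ p)

  scale-square : ∀ u p → (u ⊗ u) ≃ 1# → ((u ⊗ p) ⊗ (u ⊗ p)) ≃ (p ⊗ p)
  scale-square u p uu≃1 = ≃-trans
    (solve 2 (λ u p → (u :* p) :* (u :* p) := (u :* u) :* (p :* p)) ≃-refl u p)
    (unit-* (p ⊗ p) uu≃1)

  -- The two summands of a face step pick up the scalars `u v` and `w`; once these agree, the scalar
  -- is a common factor of the numerator.
  scale-step : ∀ u v w p q r s i → (u ⊗ v) ≃ w →
    ((((u ⊗ p) ⊗ (v ⊗ q)) ⊕ ((w ⊗ r) ⊗ s)) ⊗ i) ≃ (w ⊗ (((p ⊗ q) ⊕ (r ⊗ s)) ⊗ i))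
  scale-step u v w p q r s i uv≃w = ≃-trans
    (⊗-congʳ (⊕-cong
      (≃-trans (solve 4 (λ u v p q → (u :* p) :* (v :* q) := (u :* v) :* (p :* q)) ≃-refl u v p q)
               (⊗-congʳ uv≃w))
      ≃-refl))
    (solve 6 (λ w p q r s i → (w :* (p :* q) :+ (w :* r) :* s) :* i := w :* ((p :* q :+ r :* s) :* i))
      ≃-refl w p q r s i)

  -- The total scalar is `u v w`, which equals `w w` and hence 1. This is why the vertex step does
  -- not see the face signs.
  scale-triple : ∀ u v w t p q r → (u ⊗ v) ≃ w → (w ⊗ w) ≃ 1# →
    (((t ⊗ (u ⊗ p)) ⊗ (v ⊗ q)) ⊗ (w ⊗ r)) ≃ (((t ⊗ p) ⊗ q) ⊗ r)
  scale-triple u v w t p q r uv≃w ww≃1 = ≃-trans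
    (solve 7 (λ u v w t p q r →
      t :* (u :* p) :* (v :* q) :* (w :* r) := ((u :* v) :* w) :* (t :* p :* q :* r))
      ≃-refl u v w t p q r)
    (unit-* (((t ⊗ p) ⊗ q) ⊗ r) (≃-trans (⊗-congʳ uv≃w) ww≃1))

  -- With `a`, `b`, `c` in the roles of `α`, `β`, `γ`, the face signs at a cube are `bc`, `ac` and
  -- `ab`. Multiplying two of them squares away the letter they share, named in `cancel-a`,
  -- `cancel-b`, `cancel-c`, and leaves the third.
  cancel-a : ∀ a b c → (a ⊗ a) ≃ 1# → ((a ⊗ c) ⊗ (a ⊗ b)) ≃ (b ⊗ c)
  cancel-a a b c aa≃1 = ≃-trans
    (solve 3 (λ a b c → (a :* c) :* (a :* b) := (a :* a) :* (b :* c)) ≃-refl a b c)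
    (unit-* (b ⊗ c) aa≃1)

  cancel-b : ∀ a b c → (b ⊗ b) ≃ 1# → ((b ⊗ c) ⊗ (a ⊗ b)) ≃ (a ⊗ c)
  cancel-b a b c bb≃1 = ≃-trans
    (solve 3 (λ a b c → (b :* c) :* (a :* b) := (b :* b) :* (a :* c)) ≃-refl a b c)
    (unit-* (a ⊗ c) bb≃1)

  cancel-c : ∀ a b c → (c ⊗ c) ≃ 1# → ((b ⊗ c) ⊗ (a ⊗ c)) ≃ (a ⊗ b)
  cancel-c a b c cc≃1 = ≃-trans
    (solve 3 (λ a b c → (b :* c) :* (a :* c) := (c :* c) :* (a :* b)) ≃-refl a b c)
    (unit-* (a ⊗ b) cc≃1)

  distribute-scalars : ∀ k s t r p q e g →
    (k ⊗ (((s ⊗ p) ⊗ (t ⊗ q)) ⊕ ((r ⊗ e) ⊗ g))) ≃ (((k ⊗ (s ⊗ t)) ⊗ (p ⊗ q)) ⊕ ((k ⊗ r) ⊗ (e ⊗ g)))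
  distribute-scalars k s t r p q e g = ≃-trans (distribˡ k _ _) (⊕-cong
    (solve 5 (λ k s t p q → k :* ((s :* p) :* (t :* q)) := (k :* (s :* t)) :* (p :* q)) ≃-refl k s t p q)
    (solve 4 (λ k r e g → k :* ((r :* e) :* g) := (k :* r) :* (e :* g)) ≃-refl k r e g))

  -- Signs embedded in the ring.

  sgn+* : ∀ z → (sgn Sign.+ ⊗ z) ≃ z
  sgn+* z = unit-* z sgn+

  sgn-* : ∀ z → (sgn Sign.- ⊗ z) ≃ (⊖ z)
  sgn-* z = ≃-trans (⊗-congʳ sgn-) (-1*x≈-x z)

  sgn-homo : ∀ σ τ → sgn (σ Sign.* τ) ≃ (sgn σ ⊗ sgn τ)
  sgn-homo Sign.+ τ      = ≃-sym (sgn+* (sgn τ))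
  sgn-homo Sign.- Sign.+ = ≃-sym (≃-trans (⊗-congˡ sgn+) (*-identityʳ (sgn Sign.-)))
  sgn-homo Sign.- Sign.- = ≃-sym (≃-trans (sgn-* (sgn Sign.-))
    (≃-trans (-‿cong sgn-) (≃-trans (-‿involutive 1#) (≃-sym sgn+))))

  sgn-square : ∀ σ → (sgn σ ⊗ sgn σ) ≃ 1#
  sgn-square σ = ≃-trans (≃-sym (sgn-homo σ σ)) (subst (λ τ → sgn τ ≃ 1#) (≡.sym (Sign.s*s≡+ σ)) sgn+)

  sgn-product-square : ∀ σ τ → ((sgn σ ⊗ sgn τ) ⊗ (sgn σ ⊗ sgn τ)) ≃ 1#
  sgn-product-square σ τ = ≃-trans (scale-square (sgn σ) (sgn τ) (sgn-square σ)) (sgn-square τ)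

  sgn-cancel-a : ∀ α β γ → ((sgn α ⊗ sgn γ) ⊗ (sgn α ⊗ sgn β)) ≃ (sgn β ⊗ sgn γ)
  sgn-cancel-a α β γ = cancel-a (sgn α) (sgn β) (sgn γ) (sgn-square α)

  sgn-cancel-b : ∀ α β γ → ((sgn β ⊗ sgn γ) ⊗ (sgn α ⊗ sgn β)) ≃ (sgn α ⊗ sgn γ)
  sgn-cancel-b α β γ = cancel-b (sgn α) (sgn β) (sgn γ) (sgn-square β)

  sgn-cancel-c : ∀ α β γ → ((sgn β ⊗ sgn γ) ⊗ (sgn α ⊗ sgn γ)) ≃ (sgn α ⊗ sgn β)
  sgn-cancel-c α β γ = cancel-c (sgn α) (sgn β) (sgn γ) (sgn-square γ)

  -- Inverses and division.

  -- `inverse` takes a proof of nonvanishing and is not assumed to respect `_≃_`. Uniqueness of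
  -- inverses supplies both congruence and independence of that proof.
  inverse-unique : ∀ {w w′} w≢0 w′≢0 → w′ ≃ w → inverse w w≢0 ≃ inverse w′ w′≢0
  inverse-unique {w} {w′} w≢0 w′≢0 w′≃w = begin
    i                ≈⟨ *-identityʳ i ⟨
    i ⊗ 1#           ≈⟨ ⊗-congˡ (inverseʳ w′ w′≢0) ⟨
    i ⊗ (w′ ⊗ i′)    ≈⟨ ⊗-assoc i w′ i′ ⟨
    (i ⊗ w′) ⊗ i′    ≈⟨ ⊗-congʳ (≃-trans (⊗-congˡ w′≃w) (≃-trans (⊗-comm i w) (inverseʳ w w≢0))) ⟩
    1# ⊗ i′          ≈⟨ *-identityˡ i′ ⟩
    i′               ∎
    where
    i  = inverse w w≢0
    i′ = inverse w′ w′≢0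

  ⊗-cancel : ∀ {w z} → NonZero w → (w ⊗ z) ≃ 0# → z ≃ 0#
  ⊗-cancel {w} {z} w≢0 wz≃0 = begin
    z              ≈⟨ unit-* z (≃-trans (⊗-comm i w) (inverseʳ w w≢0)) ⟨
    (i ⊗ w) ⊗ z    ≈⟨ ⊗-assoc i w z ⟩
    i ⊗ (w ⊗ z)    ≈⟨ ⊗-congˡ wz≃0 ⟩
    i ⊗ 0#         ≈⟨ zeroʳ i ⟩
    0#             ∎
    where i = inverse w w≢0

  nonZero⇒≄0 : ∀ {z} → NonZero z → ¬ (z ≃ 0#)
  nonZero⇒≄0 {z} z≢0 z≃0 = 1≄0
    (≃-trans (≃-sym (inverseʳ z z≢0)) (≃-trans (⊗-congʳ z≃0) (zeroˡ (inverse z z≢0))))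

  divide-⊗ : ∀ {z n w} w≢0 → z ≃ divide n w w≢0 → (z ⊗ w) ≃ n
  divide-⊗ {z} {n} {w} w≢0 hz = begin
    z ⊗ w          ≈⟨ ⊗-congʳ (≃-trans hz (divide-def n w w≢0)) ⟩
    (n ⊗ i) ⊗ w    ≈⟨ ⊗-assoc n i w ⟩
    n ⊗ (i ⊗ w)    ≈⟨ ⊗-congˡ (≃-trans (⊗-comm i w) (inverseʳ w w≢0)) ⟩
    n ⊗ 1#         ≈⟨ *-identityʳ n ⟩
    n              ∎
    where i = inverse w w≢0

  -- Invariance of the hexahedron equations under sign changes.

  twist-square : ∀ σ τ p p′ r₁ r₂ r₃ r₄ r₁′ r₂′ r₃′ r₄′ → Scaled (sgn σ ⊗ sgn τ) p p′ →
    r₁′ ≃ r₁ → r₂′ ≃ r₂ → r₃′ ≃ r₃ → r₄′ ≃ r₄ →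
    (p ⊗ p) ≃ ((r₁ ⊗ r₂) ⊕ (r₃ ⊗ r₄)) → (p′ ⊗ p′) ≃ ((r₁′ ⊗ r₂′) ⊕ (r₃′ ⊗ r₄′))
  twist-square σ τ p p′ r₁ r₂ r₃ r₄ r₁′ r₂′ r₃′ r₄′ (scaled p′≃) h₁ h₂ h₃ h₄ hp = begin
    p′ ⊗ p′                                                ≈⟨ ⊗-cong p′≃ p′≃ ⟩
    ((sgn σ ⊗ sgn τ) ⊗ p) ⊗ ((sgn σ ⊗ sgn τ) ⊗ p)          ≈⟨ scale-square _ p (sgn-product-square σ τ) ⟩
    p ⊗ p                                                  ≈⟨ hp ⟩
    (r₁ ⊗ r₂) ⊕ (r₃ ⊗ r₄)                                  ≈⟨ ⊕-cong (⊗-cong h₁ h₂) (⊗-cong h₃ h₄) ⟨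
    (r₁′ ⊗ r₂′) ⊕ (r₃′ ⊗ r₄′)                              ∎

  -- One lemma serves all three directions: `e` is the far face, `r` the near face parallel to it,
  -- `p` and `q` the other two near faces, `w` the base vertex and `g` its neighbour in the
  -- direction of the step. `step-signs` uses the same letters.
  twist-step : ∀ u v t e w p q r g e′ w′ p′ q′ r′ g′ w≢0 w′≢0 → (u ⊗ v) ≃ t →
    Scaled t e e′ → Scaled u p p′ → Scaled v q q′ → Scaled t r r′ → w′ ≃ w → g′ ≃ g →
    e ≃ divide ((p ⊗ q) ⊕ (r ⊗ g)) w w≢0 → e′ ≃ divide ((p′ ⊗ q′) ⊕ (r′ ⊗ g′)) w′ w′≢0
  twist-step u v t e w p q r g e′ w′ p′ q′ r′ g′ w≢0 w′≢0 uv≃t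
    (scaled e′≃) (scaled p′≃) (scaled q′≃) (scaled r′≃) w′≃ g′≃ he = begin
    e′                                                           ≈⟨ e′≃ ⟩
    t ⊗ e                                                        ≈⟨ ⊗-congˡ (≃-trans he (divide-def _ w w≢0)) ⟩
    t ⊗ (((p ⊗ q) ⊕ (r ⊗ g)) ⊗ inverse w w≢0)                    ≈⟨ scale-step u v t p q r g (inverse w w≢0) uv≃t ⟨
    (((u ⊗ p) ⊗ (v ⊗ q)) ⊕ ((t ⊗ r) ⊗ g)) ⊗ inverse w w≢0
      ≈⟨ ⊗-cong (⊕-cong (⊗-cong (≃-sym p′≃) (≃-sym q′≃)) (⊗-cong (≃-sym r′≃) (≃-sym g′≃))) (inverse-unique w≢0 w′≢0 w′≃) ⟩
    ((p′ ⊗ q′) ⊕ (r′ ⊗ g′)) ⊗ inverse w′ w′≢0                    ≈⟨ divide-def _ w′ w′≢0 ⟨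
    divide ((p′ ⊗ q′) ⊕ (r′ ⊗ g′)) w′ w′≢0                       ∎

  A-cong : ∀ t z₀ a b c a₁ b₁ c₁ z₀′ a′ b′ c′ a₁′ b₁′ c₁′ → z₀′ ≃ z₀ →
    a′ ≃ a → b′ ≃ b → c′ ≃ c → a₁′ ≃ a₁ → b₁′ ≃ b₁ → c₁′ ≃ c₁ →
    ((((t ⊗ a′) ⊗ b′) ⊗ c′) ⊕ (z₀′ ⊗ (((a′ ⊗ a₁′) ⊕ (b′ ⊗ b₁′)) ⊕ (c′ ⊗ c₁′)))) ≃
    ((((t ⊗ a) ⊗ b) ⊗ c) ⊕ (z₀ ⊗ (((a ⊗ a₁) ⊕ (b ⊗ b₁)) ⊕ (c ⊗ c₁))))
  A-cong t z₀ a b c a₁ b₁ c₁ z₀′ a′ b′ c′ a₁′ b₁′ c₁′ h₀ ha hb hc ha₁ hb₁ hc₁ = ⊕-cong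
    (⊗-cong (⊗-cong (⊗-congˡ ha) hb) hc)
    (⊗-cong h₀ (⊕-cong (⊕-cong (⊗-cong ha ha₁) (⊗-cong hb hb₁)) (⊗-cong hc hc₁)))

  twist-vertex : ∀ u v t k A p q r w z A′ p′ q′ r′ w′ z′ w≢0 w′≢0 → (u ⊗ v) ≃ t → (t ⊗ t) ≃ 1# →
    A′ ≃ A → Scaled u p p′ → Scaled v q q′ → Scaled t r r′ → w′ ≃ w → z′ ≃ z →
    z ≃ divide (A ⊕ (((k ⊗ p) ⊗ q) ⊗ r)) (w ⊗ w) w≢0 →
    z′ ≃ divide (A′ ⊕ (((k ⊗ p′) ⊗ q′) ⊗ r′)) (w′ ⊗ w′) w′≢0
  twist-vertex u v t k A p q r w z A′ p′ q′ r′ w′ z′ w≢0 w′≢0 uv≃t tt≃1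
    A′≃ (scaled p′≃) (scaled q′≃) (scaled r′≃) w′≃ z′≃ hz = begin
    z′
      ≈⟨ ≃-trans z′≃ (≃-trans hz (divide-def _ (w ⊗ w) w≢0)) ⟩
    (A ⊕ (((k ⊗ p) ⊗ q) ⊗ r)) ⊗ inverse (w ⊗ w) w≢0
      ≈⟨ ⊗-cong (⊕-cong A′≃ (≃-trans (⊗-cong (⊗-cong (⊗-congˡ p′≃) q′≃) r′≃) (scale-triple u v t k p q r uv≃t tt≃1)))
           (≃-sym (inverse-unique w≢0 w′≢0 (⊗-cong w′≃ w′≃))) ⟨
    (A′ ⊕ (((k ⊗ p′) ⊗ q′) ⊗ r′)) ⊗ inverse (w′ ⊗ w′) w′≢0
      ≈⟨ divide-def _ (w′ ⊗ w′) w′≢0 ⟨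
    divide (A′ ⊕ (((k ⊗ p′) ⊗ q′) ⊗ r′)) (w′ ⊗ w′) w′≢0 ∎

  -- Recovering signs from the equations.

  -- The hypothesis gives `2 z = 0`, and 2 is invertible; this is where the characteristic matters.
  ⊖z≃z⇒z≃0 : ∀ z → (⊖ z) ≃ z → z ≃ 0#
  ⊖z≃z⇒z≃0 z ⊖z≃z = ⊗-cancel 2-nonZero (begin
    (1# ⊕ 1#) ⊗ z          ≈⟨ distribʳ z 1# 1# ⟩
    (1# ⊗ z) ⊕ (1# ⊗ z)    ≈⟨ ⊕-cong (*-identityˡ z) (*-identityˡ z) ⟩
    z ⊕ z                  ≈⟨ ⊕-congʳ ⊖z≃z ⟨
    (⊖ z) ⊕ z              ≈⟨ -‿inverseˡ z ⟩
    0#                     ∎)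

  equal-squares : ∀ z w → (z ⊗ z) ≃ (w ⊗ w) → ((z ⊕ (⊖ w)) ⊗ (z ⊕ w)) ≃ 0#
  equal-squares z w zz≃ww = begin
    (z ⊕ (⊖ w)) ⊗ (z ⊕ w)
      -- The solver sees `⊖ w` as an independent atom `n`; the terms are grouped so that `n + w`
      -- vanishes and `z z + n w` becomes a difference of squares.
      ≈⟨ solve 3 (λ z n w → (z :+ n) :* (z :+ w) := z :* (n :+ w) :+ (z :* z :+ n :* w)) ≃-refl z (⊖ w) w ⟩
    (z ⊗ ((⊖ w) ⊕ w)) ⊕ ((z ⊗ z) ⊕ ((⊖ w) ⊗ w))
      ≈⟨ ⊕-cong (≃-trans (⊗-congˡ (-‿inverseˡ w)) (zeroʳ z)) (⊕-congˡ (≃-sym (-‿distribˡ-* w w))) ⟩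
    0# ⊕ ((z ⊗ z) ⊕ (⊖ (w ⊗ w)))
      ≈⟨ ≃-trans (+-identityˡ _) (x≈y⇒x∙y⁻¹≈ε zz≃ww) ⟩
    0# ∎

  square-roots : ∀ w z → NonZero w → (z ⊗ z) ≃ (w ⊗ w) → ∃ λ σ → Scaled (sgn σ) w z
  square-roots w z w≢0 zz≃ww with ±-nonZero z w w≢0
  -- An invertible `z - w` is cancelled from `(z - w)(z + w) = 0`, so the other factor vanishes and
  -- the sign is minus; the second case is the mirror image.
  ... | inj₁ z-w≢0 = Sign.- , scaled (begin
      z              ≈⟨ -‿involutive z ⟨
      ⊖ (⊖ z)        ≈⟨ -‿cong (+-inverseʳ-unique z w (⊗-cancel z-w≢0 (equal-squares z w zz≃ww))) ⟨
      ⊖ w            ≈⟨ sgn-* w ⟨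
      sgn Sign.- ⊗ w ∎)
  ... | inj₂ z+w≢0 = Sign.+ , scaled (≃-trans
      (x∙y⁻¹≈ε⇒x≈y z w (⊗-cancel z+w≢0 (≃-trans (⊗-comm (z ⊕ w) (z ⊕ (⊖ w))) (equal-squares z w zz≃ww))))
      (≃-sym (sgn+* w)))

  face-sign : ∀ p p′ r₁ r₂ r₃ r₄ r₁′ r₂′ r₃′ r₄′ → NonZero p →
    r₁′ ≃ r₁ → r₂′ ≃ r₂ → r₃′ ≃ r₃ → r₄′ ≃ r₄ →
    (p ⊗ p) ≃ ((r₁ ⊗ r₂) ⊕ (r₃ ⊗ r₄)) → (p′ ⊗ p′) ≃ ((r₁′ ⊗ r₂′) ⊕ (r₃′ ⊗ r₄′)) →
    ∃ λ σ → Scaled (sgn σ) p p′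
  face-sign p p′ r₁ r₂ r₃ r₄ r₁′ r₂′ r₃′ r₄′ p≢0 h₁ h₂ h₃ h₄ hp hp′ = square-roots p p′ p≢0
    (≃-trans hp′ (≃-trans (⊕-cong (⊗-cong h₁ h₂) (⊗-cong h₃ h₄)) (≃-sym hp)))

  -- Each other choice of signs reduces the equation to `-t = t` with `t` one of `q`, `p`, `p + q`,
  -- so each of the three nonvanishing hypotheses rules out one case.
  signs-trivial : ∀ σ τ {p q} → ¬ (p ≃ 0#) → ¬ (q ≃ 0#) → ¬ ((p ⊕ q) ≃ 0#) →
    ((sgn σ ⊗ p) ⊕ (sgn τ ⊗ q)) ≃ (p ⊕ q) → σ ≡ Sign.+ × τ ≡ Sign.+
  signs-trivial Sign.+ Sign.+ p≄0 q≄0 p+q≄0 h = ≡.refl , ≡.refl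
  signs-trivial Sign.+ Sign.- {p} {q} p≄0 q≄0 p+q≄0 h = contradiction
    (⊖z≃z⇒z≃0 q (+-cancelˡ p (⊖ q) q (≃-trans (≃-sym (⊕-cong (sgn+* p) (sgn-* q))) h))) q≄0
  signs-trivial Sign.- Sign.+ {p} {q} p≄0 q≄0 p+q≄0 h = contradiction
    (⊖z≃z⇒z≃0 p (+-cancelʳ q (⊖ p) p (≃-trans (≃-sym (⊕-cong (sgn-* p) (sgn+* q))) h))) p≄0
  signs-trivial Sign.- Sign.- {p} {q} p≄0 q≄0 p+q≄0 h = contradiction
    (⊖z≃z⇒z≃0 (p ⊕ q)
      (≃-trans (≃-sym (≃-trans (⊕-cong (sgn-* p) (sgn-* q)) (-‿+-comm p q))) h)) p+q≄0

  -- Multiplying the primed equation by κ and comparing it with the other one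
  -- gives κστ pq + κρ rg = pq + rg; as pq, rg and their sum are nonzero, both
  -- signs are +.
  step-signs : ∀ κ σ τ ρ e w p q r g e′ w′ p′ q′ r′ g′ w≢0 w′≢0 →
    NonZero e → NonZero p → NonZero q → NonZero r → NonZero g →
    Scaled (sgn κ) e e′ → Scaled (sgn σ) p p′ → Scaled (sgn τ) q q′ → Scaled (sgn ρ) r r′ → w′ ≃ w → g′ ≃ g →
    e ≃ divide ((p ⊗ q) ⊕ (r ⊗ g)) w w≢0 → e′ ≃ divide ((p′ ⊗ q′) ⊕ (r′ ⊗ g′)) w′ w′≢0 →
    κ ≡ ρ × σ Sign.* τ ≡ κ
  step-signs κ σ τ ρ e w p q r g e′ w′ p′ q′ r′ g′ w≢0 w′≢0
    e≢0 p≢0 q≢0 r≢0 g≢0 (scaled e′≃) (scaled p′≃) (scaled q′≃) (scaled r′≃) w′≃ g′≃ he he′ =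
    s*t≡+⇒s≡t κ ρ (proj₂ trivial) , ≡.sym (s*t≡+⇒s≡t κ (σ Sign.* τ) (proj₁ trivial))
    where
    step : (e ⊗ w) ≃ ((p ⊗ q) ⊕ (r ⊗ g))
    step = divide-⊗ w≢0 he
    trivial : κ Sign.* (σ Sign.* τ) ≡ Sign.+ × κ Sign.* ρ ≡ Sign.+
    trivial = signs-trivial (κ Sign.* (σ Sign.* τ)) (κ Sign.* ρ)
      (nonZero⇒≄0 (⊗-nonZero p q p≢0 q≢0)) (nonZero⇒≄0 (⊗-nonZero r g r≢0 g≢0))
      -- The numerator equals `e w`, a product of the far face and the base vertex, both nonzero.
      (λ sum≃0 → nonZero⇒≄0 (⊗-nonZero e w e≢0 w≢0) (≃-trans step sum≃0)) (begin
      (sgn (κ Sign.* (σ Sign.* τ)) ⊗ (p ⊗ q)) ⊕ (sgn (κ Sign.* ρ) ⊗ (r ⊗ g))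
        ≈⟨ ⊕-cong
             (⊗-congʳ (≃-trans (sgn-homo κ (σ Sign.* τ)) (⊗-congˡ (sgn-homo σ τ))))
             (⊗-congʳ (sgn-homo κ ρ)) ⟩
      ((sgn κ ⊗ (sgn σ ⊗ sgn τ)) ⊗ (p ⊗ q)) ⊕ ((sgn κ ⊗ sgn ρ) ⊗ (r ⊗ g))
        ≈⟨ distribute-scalars (sgn κ) (sgn σ) (sgn τ) (sgn ρ) p q r g ⟨
      sgn κ ⊗ (((sgn σ ⊗ p) ⊗ (sgn τ ⊗ q)) ⊕ ((sgn ρ ⊗ r) ⊗ g))
        ≈⟨ ⊗-congˡ (⊕-cong (⊗-cong p′≃ q′≃) (⊗-cong r′≃ g′≃)) ⟨
      sgn κ ⊗ ((p′ ⊗ q′) ⊕ (r′ ⊗ g′))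
        ≈⟨ ⊗-congˡ (≃-trans (≃-sym (divide-⊗ w′≢0 he′)) (⊗-cong e′≃ w′≃)) ⟩
      sgn κ ⊗ ((sgn κ ⊗ e) ⊗ w)
        ≈⟨ ≃-trans (⊗-congˡ (⊗-assoc (sgn κ) e w)) (≃-sym (⊗-assoc (sgn κ) (sgn κ) (e ⊗ w))) ⟩
      (sgn κ ⊗ sgn κ) ⊗ (e ⊗ w)
        ≈⟨ unit-* (e ⊗ w) (sgn-square κ) ⟩
      e ⊗ w
        ≈⟨ step ⟩
      (p ⊗ q) ⊕ (r ⊗ g) ∎)

  factor : ∀ σ ρ τ p p′ → Scaled (sgn σ) p p′ → σ ≡ ρ Sign.* τ → p′ ≃ ((sgn ρ ⊗ sgn τ) ⊗ p)
  factor σ ρ τ p p′ (scaled h) ≡.refl = ≃-trans h (⊗-congʳ (sgn-homo ρ τ))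

-- Factoring sign functions on the integer lattice.

-- Induction outwards from zero in both directions. `sucℤ` computes on each of the patterns, so for
-- negative arguments the hypothesis is simply read backwards.
shift-invariant⇒constant : (f : ℤ → Sign) → (∀ a → f (sucℤ a) ≡ f a) → ∀ a → f a ≡ f 0ℤ
shift-invariant⇒constant f h (ℤ.+ ℕ.zero)    = ≡.refl
shift-invariant⇒constant f h (ℤ.+ ℕ.suc n)   = ≡.trans (h (ℤ.+ n)) (shift-invariant⇒constant f h (ℤ.+ n))
shift-invariant⇒constant f h -[1+ ℕ.zero ]   = ≡.sym (h -[1+ 0 ])
shift-invariant⇒constant f h -[1+ ℕ.suc n ]  =
  ≡.trans (≡.sym (h -[1+ ℕ.suc n ])) (shift-invariant⇒constant f h -[1+ n ])

-- Setting one index to zero in the relation expresses each of `T`, `U`, `V` through its values on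
-- the axes: `a = 0` for `T`, `b = 0` for `U`, `c = 0` for `V`. The factors are determined only up
-- to flipping all three at once.
sign-factorization : (T U V : ℤ → ℤ → Sign) → (∀ a b c → U a c Sign.* V a b ≡ T b c) →
  Σ[ α ∈ (ℤ → Sign) ] Σ[ β ∈ (ℤ → Sign) ] Σ[ γ ∈ (ℤ → Sign) ]
    (∀ b c → T b c ≡ β b Sign.* γ c) ×
    (∀ a c → U a c ≡ α a Sign.* γ c) ×
    (∀ a b → V a b ≡ α a Sign.* β b)
sign-factorization T U V h = α , V 0ℤ , U 0ℤ , T≡βγ , U≡αγ , V≡αβ
  where
  open ≡.≡-Reasoning
  α : ℤ → Sign
  -- Forced by `V a 0 = α a * β 0` with `β 0 = V 0 0`, since a sign is its own inverse.
  α a = V a 0ℤ Sign.* V 0ℤ 0ℤ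

  T≡βγ : ∀ b c → T b c ≡ V 0ℤ b Sign.* U 0ℤ c
  T≡βγ b c = ≡.trans (≡.sym (h 0ℤ b c)) (Sign.*-comm (U 0ℤ c) (V 0ℤ b))

  U≡αγ : ∀ a c → U a c ≡ α a Sign.* U 0ℤ c
  U≡αγ a c = begin
    U a c                                         ≡⟨ s*t≡r⇒s≡t*r (U a c) (V a 0ℤ) (≡.trans (h a 0ℤ c) (T≡βγ 0ℤ c)) ⟩
    V a 0ℤ Sign.* (V 0ℤ 0ℤ Sign.* U 0ℤ c)         ≡⟨ Sign.*-assoc (V a 0ℤ) (V 0ℤ 0ℤ) (U 0ℤ c) ⟨
    α a Sign.* U 0ℤ c                             ∎

  V≡αβ : ∀ a b → V a b ≡ α a Sign.* V 0ℤ b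
  V≡αβ a b = begin
    V a b
      ≡⟨ s*t≡r⇒s≡t*r (V a b) (U a 0ℤ) (≡.trans (Sign.*-comm (V a b) (U a 0ℤ)) (h a b 0ℤ)) ⟩
    U a 0ℤ Sign.* T b 0ℤ
      ≡⟨ cong₂ Sign._*_ (U≡αγ a 0ℤ) (≡.sym (h 0ℤ b 0ℤ)) ⟩
    (α a Sign.* U 0ℤ 0ℤ) Sign.* (U 0ℤ 0ℤ Sign.* V 0ℤ b)
      ≡⟨ Sign.*-assoc (α a) (U 0ℤ 0ℤ) (U 0ℤ 0ℤ Sign.* V 0ℤ b) ⟩
    α a Sign.* (U 0ℤ 0ℤ Sign.* (U 0ℤ 0ℤ Sign.* V 0ℤ b))
      ≡⟨ cong (α a Sign.*_) (Sign.*-assoc (U 0ℤ 0ℤ) (U 0ℤ 0ℤ) (V 0ℤ b)) ⟨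
    -- `U 0 0` enters twice, as `γ 0` and through `T b 0 = U 0 0 * V 0 b`, and so cancels.
    α a Sign.* ((U 0ℤ 0ℤ Sign.* U 0ℤ 0ℤ) Sign.* V 0ℤ b)
      ≡⟨ cong (λ s → α a Sign.* (s Sign.* V 0ℤ b)) (Sign.s*s≡+ (U 0ℤ 0ℤ)) ⟩
    α a Sign.* V 0ℤ b ∎

-- The sign of a face is constant along the normal of the face, so all three functions restrict to
-- coordinate planes, where the relation at each cube becomes the two-variable one.
box-sign-factorization : (T U V : ℤ → ℤ → ℤ → Sign) →
  (∀ a b c → T (sucℤ a) b c ≡ T a b c × U a b c Sign.* V a b c ≡ T (sucℤ a) b c) →
  (∀ a b c → U a (sucℤ b) c ≡ U a b c) → (∀ a b c → V a b (sucℤ c) ≡ V a b c) →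
  Σ[ α ∈ (ℤ → Sign) ] Σ[ β ∈ (ℤ → Sign) ] Σ[ γ ∈ (ℤ → Sign) ]
    (∀ a b c → T a b c ≡ β b Sign.* γ c) ×
    (∀ a b c → U a b c ≡ α a Sign.* γ c) ×
    (∀ a b c → V a b c ≡ α a Sign.* β b)
box-sign-factorization T U V T-relation U-invariant V-invariant =
  let α , β , γ , T≡βγ , U≡αγ , V≡αβ = sign-factorization (T 0ℤ) (λ a c → U a 0ℤ c) (λ a b → V a b 0ℤ) U*V≡T
  in α , β , γ
    , (λ a b c → ≡.trans (T-constant a b c) (T≡βγ b c))
    , (λ a b c → ≡.trans (U-constant a b c) (U≡αγ a c))
    , (λ a b c → ≡.trans (V-constant a b c) (V≡αβ a b))
  where
  T-constant : ∀ a b c → T a b c ≡ T 0ℤ b c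
  T-constant a b c = shift-invariant⇒constant (λ a → T a b c) (λ a → proj₁ (T-relation a b c)) a

  U-constant : ∀ a b c → U a b c ≡ U a 0ℤ c
  U-constant a b c = shift-invariant⇒constant (λ b → U a b c) (λ b → U-invariant a b c) b

  V-constant : ∀ a b c → V a b c ≡ V a b 0ℤ
  V-constant a b c = shift-invariant⇒constant (V a b) (V-invariant a b) c

  U*V≡T : ∀ a b c → U a 0ℤ c Sign.* V a b 0ℤ ≡ T 0ℤ b c
  U*V≡T a b c = ≡.trans (≡.sym (cong₂ Sign._*_ (U-constant a b c) (V-constant a b c)))
    (≡.trans (proj₂ (T-relation a b c)) (T-constant (sucℤ a) b c))

-- Specialisation to the complex numbers.

2≢0 : 1ℂ + 1ℂ ≢0
2≢0 = 1ℚ , 0<1 , 0 , λ _ _ → toWitness {a? = 1ℚ ℚ.≤? _} _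

±-≢0 : ∀ z w → w ≢0 → (z + - w ≢0) ⊎ (z + w ≢0)
±-≢0 z w w≢0 = Positive-split (normSq (z + - w)) (normSq (z + w)) (parallelogram-positive z w w≢0)

≋-refl : ∀ z → z ≋ z
≋-refl z = ≡⇒≋ (λ _ → ≡.refl) (λ _ → ≡.refl)

open SignTwists ℂ-isCommutativeRing _≢0 invℂ (λ z z≢0 → wrap (*-inverseʳ z z≢0)) (λ z w → *-≢0 {z} {w})
  1≄0 2≢0 ±-≢0 _/_⟨_⟩ (λ z w w≢0 → ≋-refl (z * invℂ w w≢0)) ⟦_⟧ (≋-refl 1ℂ) (≋-refl (- 1ℂ))

⟦⟧-≢0 : ∀ σ → ⟦ σ ⟧ ≢0
⟦⟧-≢0 Sign.+ = 1ℚ , 0<1 , 0 , λ _ _ → ℚ.≤-refl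
⟦⟧-≢0 Sign.- = 1ℚ , 0<1 , 0 , λ _ _ → ℚ.≤-refl

product-≢0 : ∀ σ τ z → z ≢0 → ⟦ σ ⟧ * ⟦ τ ⟧ * z ≢0
product-≢0 σ τ z z≢0 =
  *-≢0 {⟦ σ ⟧ * ⟦ τ ⟧} {z} (*-≢0 {⟦ σ ⟧} {⟦ τ ⟧} (⟦⟧-≢0 σ) (⟦⟧-≢0 τ)) z≢0

resign-≢0 : ∀ α β γ x → (∀ s → x s ≢0) → ∀ s → resign α β γ x s ≢0
resign-≢0 α β γ x x≢0 (vertex a b c) = x≢0 (vertex a b c)
resign-≢0 α β γ x x≢0 (yz a b c)     = product-≢0 (β b) (γ c) (x (yz a b c)) (x≢0 (yz a b c))
resign-≢0 α β γ x x≢0 (xz a b c)     = product-≢0 (α a) (γ c) (x (xz a b c)) (x≢0 (xz a b c))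
resign-≢0 α β γ x x≢0 (xy a b c)     = product-≢0 (α a) (β b) (x (xy a b c)) (x≢0 (xy a b c))

-- Part (a): sign changes preserve the equations.

-- The array `y` is kept abstract, with its relation to `x` as hypotheses; for `resign` these hold
-- by reflexivity.
twist-KHexahedron : (α β γ : ℤ → Sign) (x y : L → ℂ) → KHexahedron x → (∀ a b c → y (vertex a b c) ≢0) →
  (∀ a b c → y (vertex a b c) ≋ x (vertex a b c)) →
  (∀ a b c → Scaled (⟦ β b ⟧ * ⟦ γ c ⟧) (x (yz a b c)) (y (yz a b c))) →
  (∀ a b c → Scaled (⟦ α a ⟧ * ⟦ γ c ⟧) (x (xz a b c)) (y (xz a b c))) →
  (∀ a b c → Scaled (⟦ α a ⟧ * ⟦ β b ⟧) (x (xy a b c)) (y (xy a b c))) →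
  KHexahedron y
twist-KHexahedron α β γ x y hx y≢0 y≋x yz-scaled xz-scaled xy-scaled = record
  { vertex≢0  = y≢0
  ; yz-square = λ a b c →
      let open Cube x a b c
          module Y = Cube y a b c
      in unwrap
      (twist-square (β b) (γ c) z0½½ Y.z0½½ z000 z011 z010 z001 Y.z000 Y.z011 Y.z010 Y.z001
        (yz-scaled a b c) (y≋x _ _ _) (y≋x _ _ _) (y≋x _ _ _) (y≋x _ _ _) (wrap (yz-square a b c)))
  ; xz-square = λ a b c →
      let open Cube x a b c
          module Y = Cube y a b c
      in unwrap
      (twist-square (α a) (γ c) z½0½ Y.z½0½ z000 z101 z100 z001 Y.z000 Y.z101 Y.z100 Y.z001
        (xz-scaled a b c) (y≋x _ _ _) (y≋x _ _ _) (y≋x _ _ _) (y≋x _ _ _) (wrap (xz-square a b c)))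
  ; xy-square = λ a b c →
      let open Cube x a b c
          module Y = Cube y a b c
      in unwrap
      (twist-square (α a) (β b) z½½0 Y.z½½0 z000 z110 z100 z010 Y.z000 Y.z110 Y.z100 Y.z010
        (xy-scaled a b c) (y≋x _ _ _) (y≋x _ _ _) (y≋x _ _ _) (y≋x _ _ _) (wrap (xy-square a b c)))
  ; yz-step = λ a b c →
      let open Cube x a b c
          module Y = Cube y a b c
      in unwrap
      (twist-step (⟦ α a ⟧ * ⟦ γ c ⟧) (⟦ α a ⟧ * ⟦ β b ⟧) (⟦ β b ⟧ * ⟦ γ c ⟧)
        z1½½ z000 z½0½ z½½0 z0½½ z100 Y.z1½½ Y.z000 Y.z½0½ Y.z½½0 Y.z0½½ Y.z100
        (vertex≢0 a b c) (y≢0 a b c) (sgn-cancel-a (α a) (β b) (γ c))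
        -- The sign of a `yz` face does not involve its first coordinate, so the far face at
        -- `sucℤ a` and the near face at `a` share one scalar. The other two directions work alike.
        (yz-scaled (sucℤ a) b c) (xz-scaled a b c) (xy-scaled a b c) (yz-scaled a b c) (y≋x _ _ _) (y≋x _ _ _)
        (wrap (yz-step a b c)))
  ; xz-step = λ a b c →
      let open Cube x a b c
          module Y = Cube y a b c
      in unwrap
      (twist-step (⟦ β b ⟧ * ⟦ γ c ⟧) (⟦ α a ⟧ * ⟦ β b ⟧) (⟦ α a ⟧ * ⟦ γ c ⟧)
        z½1½ z000 z0½½ z½½0 z½0½ z010 Y.z½1½ Y.z000 Y.z0½½ Y.z½½0 Y.z½0½ Y.z010
        (vertex≢0 a b c) (y≢0 a b c) (sgn-cancel-b (α a) (β b) (γ c))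
        (xz-scaled a (sucℤ b) c) (yz-scaled a b c) (xy-scaled a b c) (xz-scaled a b c) (y≋x _ _ _) (y≋x _ _ _)
        (wrap (xz-step a b c)))
  ; xy-step = λ a b c →
      let open Cube x a b c
          module Y = Cube y a b c
      in unwrap
      (twist-step (⟦ β b ⟧ * ⟦ γ c ⟧) (⟦ α a ⟧ * ⟦ γ c ⟧) (⟦ α a ⟧ * ⟦ β b ⟧)
        z½½1 z000 z0½½ z½0½ z½½0 z001 Y.z½½1 Y.z000 Y.z0½½ Y.z½0½ Y.z½½0 Y.z001
        (vertex≢0 a b c) (y≢0 a b c) (sgn-cancel-c (α a) (β b) (γ c))
        (xy-scaled a b (sucℤ c)) (yz-scaled a b c) (xz-scaled a b c) (xy-scaled a b c) (y≋x _ _ _) (y≋x _ _ _)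
        (wrap (xy-step a b c)))
  ; vertex-step = λ a b c →
      let open Cube x a b c
          module Y = Cube y a b c
      in unwrap
      (twist-vertex (⟦ β b ⟧ * ⟦ γ c ⟧) (⟦ α a ⟧ * ⟦ γ c ⟧) (⟦ α a ⟧ * ⟦ β b ⟧) 2ℂ
        A z0½½ z½0½ z½½0 z000 z111 Y.A Y.z0½½ Y.z½0½ Y.z½½0 Y.z000 Y.z111
        (*-≢0 {z000} {z000} (vertex≢0 a b c) (vertex≢0 a b c))
        (*-≢0 {Y.z000} {Y.z000} (y≢0 a b c) (y≢0 a b c))
        (sgn-cancel-c (α a) (β b) (γ c)) (sgn-product-square (α a) (β b))
        (A-cong 2ℂ z000 z100 z010 z001 z011 z101 z110 Y.z000 Y.z100 Y.z010 Y.z001 Y.z011 Y.z101 Y.z110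
          (y≋x _ _ _) (y≋x _ _ _) (y≋x _ _ _) (y≋x _ _ _) (y≋x _ _ _) (y≋x _ _ _) (y≋x _ _ _))
        (yz-scaled a b c) (xz-scaled a b c) (xy-scaled a b c) (y≋x _ _ _) (y≋x _ _ _) (wrap (vertex-step a b c)))
  }
  where open KHexahedron hx

-- Part (b): arrays agreeing on the vertices.

module SameVertices (x : L → ℂ) (x≢0 : ∀ s → x s ≢0) (hx : KHexahedron x)
                    (y : L → ℂ) (hy : KHexahedron y)
                    (y≈x : ∀ a b c → y (vertex a b c) ≈ x (vertex a b c)) where
  module HX = KHexahedron hx
  module HY = KHexahedron hy

  y≋x : ∀ a b c → y (vertex a b c) ≋ x (vertex a b c)
  y≋x a b c = wrap (y≈x a b c)

  yz-sign : ∀ a b c → ∃ λ σ → Scaled ⟦ σ ⟧ (x (yz a b c)) (y (yz a b c))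
  yz-sign a b c =
    let open Cube x a b c
        module Y = Cube y a b c
    in
    face-sign z0½½ Y.z0½½ z000 z011 z010 z001 Y.z000 Y.z011 Y.z010 Y.z001 (x≢0 (yz a b c))
      (y≋x _ _ _) (y≋x _ _ _) (y≋x _ _ _) (y≋x _ _ _) (wrap (HX.yz-square a b c)) (wrap (HY.yz-square a b c))

  xz-sign : ∀ a b c → ∃ λ σ → Scaled ⟦ σ ⟧ (x (xz a b c)) (y (xz a b c))
  xz-sign a b c =
    let open Cube x a b c
        module Y = Cube y a b c
    in
    face-sign z½0½ Y.z½0½ z000 z101 z100 z001 Y.z000 Y.z101 Y.z100 Y.z001 (x≢0 (xz a b c))
      (y≋x _ _ _) (y≋x _ _ _) (y≋x _ _ _) (y≋x _ _ _) (wrap (HX.xz-square a b c)) (wrap (HY.xz-square a b c))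

  xy-sign : ∀ a b c → ∃ λ σ → Scaled ⟦ σ ⟧ (x (xy a b c)) (y (xy a b c))
  xy-sign a b c =
    let open Cube x a b c
        module Y = Cube y a b c
    in
    face-sign z½½0 Y.z½½0 z000 z110 z100 z010 Y.z000 Y.z110 Y.z100 Y.z010 (x≢0 (xy a b c))
      (y≋x _ _ _) (y≋x _ _ _) (y≋x _ _ _) (y≋x _ _ _) (wrap (HX.xy-square a b c)) (wrap (HY.xy-square a b c))

  -- At this stage each sign may depend on all three coordinates; the face steps then remove one of
  -- them. As `∃` carries its witness, projecting makes these functions.
  T U V : ℤ → ℤ → ℤ → Sign
  T a b c = proj₁ (yz-sign a b c)
  U a b c = proj₁ (xz-sign a b c)
  V a b c = proj₁ (xy-sign a b c)

  yz-relation : ∀ a b c → T (sucℤ a) b c ≡ T a b c × U a b c Sign.* V a b c ≡ T (sucℤ a) b c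
  yz-relation a b c =
    let open Cube x a b c
        module Y = Cube y a b c
    in
    step-signs (T (sucℤ a) b c) (U a b c) (V a b c) (T a b c)
      z1½½ z000 z½0½ z½½0 z0½½ z100 Y.z1½½ Y.z000 Y.z½0½ Y.z½½0 Y.z0½½ Y.z100
      (HX.vertex≢0 a b c) (HY.vertex≢0 a b c)
      (x≢0 (yz (sucℤ a) b c)) (x≢0 (xz a b c)) (x≢0 (xy a b c)) (x≢0 (yz a b c)) (x≢0 (vertex (sucℤ a) b c))
      (proj₂ (yz-sign (sucℤ a) b c)) (proj₂ (xz-sign a b c)) (proj₂ (xy-sign a b c)) (proj₂ (yz-sign a b c))
      (y≋x a b c) (y≋x (sucℤ a) b c) (wrap (HX.yz-step a b c)) (wrap (HY.yz-step a b c))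

  xz-invariant : ∀ a b c → U a (sucℤ b) c ≡ U a b c
  xz-invariant a b c =
    let open Cube x a b c
        module Y = Cube y a b c
    in
    proj₁ (step-signs (U a (sucℤ b) c) (T a b c) (V a b c) (U a b c)
      z½1½ z000 z0½½ z½½0 z½0½ z010 Y.z½1½ Y.z000 Y.z0½½ Y.z½½0 Y.z½0½ Y.z010
      (HX.vertex≢0 a b c) (HY.vertex≢0 a b c)
      (x≢0 (xz a (sucℤ b) c)) (x≢0 (yz a b c)) (x≢0 (xy a b c)) (x≢0 (xz a b c)) (x≢0 (vertex a (sucℤ b) c))
      (proj₂ (xz-sign a (sucℤ b) c)) (proj₂ (yz-sign a b c)) (proj₂ (xy-sign a b c)) (proj₂ (xz-sign a b c))
      (y≋x a b c) (y≋x a (sucℤ b) c) (wrap (HX.xz-step a b c)) (wrap (HY.xz-step a b c)))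

  xy-invariant : ∀ a b c → V a b (sucℤ c) ≡ V a b c
  xy-invariant a b c =
    let open Cube x a b c
        module Y = Cube y a b c
    in
    proj₁ (step-signs (V a b (sucℤ c)) (T a b c) (U a b c) (V a b c)
      z½½1 z000 z0½½ z½0½ z½½0 z001 Y.z½½1 Y.z000 Y.z0½½ Y.z½0½ Y.z½½0 Y.z001
      (HX.vertex≢0 a b c) (HY.vertex≢0 a b c)
      (x≢0 (xy a b (sucℤ c))) (x≢0 (yz a b c)) (x≢0 (xz a b c)) (x≢0 (xy a b c)) (x≢0 (vertex a b (sucℤ c)))
      (proj₂ (xy-sign a b (sucℤ c))) (proj₂ (yz-sign a b c)) (proj₂ (xz-sign a b c)) (proj₂ (xy-sign a b c))
      (y≋x a b c) (y≋x a b (sucℤ c)) (wrap (HX.xy-step a b c)) (wrap (HY.xy-step a b c)))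

  y≋resign : (α β γ : ℤ → Sign) →
    (∀ a b c → T a b c ≡ β b Sign.* γ c) →
    (∀ a b c → U a b c ≡ α a Sign.* γ c) →
    (∀ a b c → V a b c ≡ α a Sign.* β b) →
    ∀ s → y s ≋ resign α β γ x s
  y≋resign α β γ T≡βγ U≡αγ V≡αβ (vertex a b c) = y≋x a b c
  y≋resign α β γ T≡βγ U≡αγ V≡αβ (yz a b c) =
    factor (T a b c) (β b) (γ c) (x (yz a b c)) (y (yz a b c)) (proj₂ (yz-sign a b c)) (T≡βγ a b c)
  y≋resign α β γ T≡βγ U≡αγ V≡αβ (xz a b c) =
    factor (U a b c) (α a) (γ c) (x (xz a b c)) (y (xz a b c)) (proj₂ (xz-sign a b c)) (U≡αγ a b c)
  y≋resign α β γ T≡βγ U≡αγ V≡αβ (xy a b c) =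
    factor (V a b c) (α a) (β b) (x (xy a b c)) (y (xy a b c)) (proj₂ (xy-sign a b c)) (V≡αβ a b c)

  resigned : ∃[ α ] ∃[ β ] ∃[ γ ] (∀ s → y s ≈ resign α β γ x s)
  resigned =
    let α , β , γ , T≡βγ , U≡αγ , V≡αβ = box-sign-factorization T U V yz-relation xz-invariant xy-invariant
    in α , β , γ , λ s → unwrap (y≋resign α β γ T≡βγ U≡αγ V≡αβ s)

theorem2p23 : (x : L → ℂ) → (∀ s → x s ≢0) → KHexahedron x →
    ((α β γ : ℤ → Sign) →
    (∀ s → resign α β γ x s ≢0) × KHexahedron (resign α β γ x))
    ×
    ((y : L → ℂ) → (∀ s → y s ≢0) → KHexahedron y →
    (∀ a b c → y (vertex a b c) ≈ x (vertex a b c)) →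
    ∃[ α ] ∃[ β ] ∃[ γ ] (∀ s → y s ≈ resign α β γ x s))
theorem2p23 x x≢0 hx =
  (λ α β γ → resign-≢0 α β γ x x≢0 ,
    -- `resign` fixes vertices by definition, so the nonvanishing proofs in `hx` serve unchanged for
    -- the new array.
    twist-KHexahedron α β γ x (resign α β γ x) hx (KHexahedron.vertex≢0 hx)
      (λ a b c → ≋-refl (x (vertex a b c)))
      (λ a b c → scaled (≋-refl (resign α β γ x (yz a b c))))
      (λ a b c → scaled (≋-refl (resign α β γ x (xz a b c))))
      (λ a b c → scaled (≋-refl (resign α β γ x (xy a b c))))) ,
  (λ y _ hy y≈x → SameVertices.resigned x x≢0 hx y hy y≈x)
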